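{- Let $0<\theta<1$, $k=n^\theta$, $\varepsilon>0$, and let $$m_{\mathrm{para}}=2\,\frac{k\ln(n/k)}{\ln k}=2\,\frac{1-\theta}{\theta}\,k.$$ If $m>(1+\varepsilon)\,m_{\mathrm{para}}$, then $\boldsymbol\sigma$ can be computed from $\boldsymbol G$ and $\boldsymbol y$ with high probability (with unlimited computational power); that is, there is a function of $(\boldsymbol G,\boldsymbol y)$ whose value equals $\boldsymbol\sigma$ with probability tending to $1$ as $n\to\infty$.
   Context: $\boldsymbol\sigma$ is uniformly random among all vectors in $\{0,1\}^n$ with exactly $k$ ones. $\boldsymbol G$ is a random bipartite multigraph (independent of $\boldsymbol\sigma$) with entry-nodes $x_1,\dots,x_n$ and query-nodes $a_1,\dots,a_m$: each query independently contains exactly $\Gamma=n/2$ entries chosen uniformly at random with replacement, so multi-edges may occur. The query results are $\boldsymbol y=(\boldsymbol y_1,\dots,\boldsymbol y_m)$, where $\boldsymbol y_j=\sum_{x_i\in\partial a_j}\boldsymbol\sigma(i)$ and $\partial a_j$ is the multiset of entries contained in $a_j$ (so the sum counts multiplicities). Here $\theta,\varepsilon$ are fixed, $n$ and $k$ are known, $m=m(n)$, and integer rounding is suppressed. -}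

module Defs where

import Algebra.Definitions.RawSemiring
open import Data.Fin as Fin using (Fin)
open import Data.Integer as ℤ using (+_)
open import Data.List as List using (List; length; filter; allFin; cartesianProduct; cartesianProductWith)
open import Data.Nat as ℕ using (ℕ; zero; suc)
open import Data.Product using (_×_; _,_; ∃-syntax)
open import Data.Rational as ℚ using (ℚ; 0ℚ; 1ℚ; ↥_; ↧ₙ_)
open import Data.Sum using (_⊎_)
open import Data.Vec as Vec using (Vec; []; _∷_)
open import Data.Vec.Properties using (≡-dec)
open import Function using (_⇔_)
open import Level using (0ℓ)
open import Relation.Nullary using (¬_)
open import Relation.Unary using (Pred; Decidable)

private module ℚ-Semiring = Algebra.Definitions.RawSemiring ℚ.+-*-rawSemiring

-- Real numbers as Dedekind cuts of ℚ. The operations act on arbitrary pairs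
-- of predicates; they have their usual meaning on arguments that satisfy
-- IsDedekind, subject to the side conditions noted at _⁻¹ʳ and _^ʳ_.

record Cut : Set₁ where
  field
    Lower Upper : ℚ → Set

open Cut public

record IsDedekind (x : Cut) : Set where
  field
    lower-inhabited : ∃[ q ] Lower x q
    upper-inhabited : ∃[ q ] Upper x q
    lower-rounded   : ∀ q → Lower x q ⇔ (∃[ r ] q ℚ.< r × Lower x r)
    upper-rounded   : ∀ q → Upper x q ⇔ (∃[ r ] r ℚ.< q × Upper x r)
    disjoint        : ∀ q → ¬ (Lower x q × Upper x q)
    located         : ∀ q r → q ℚ.< r → Lower x q ⊎ Upper x r

infix  4 _<ʳ_
infixl 6 _+ʳ_ _-ʳ_
infixl 7 _*ʳ_
infix  8 -ʳ_
infixl 8 _⁻¹ʳ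
infixr 9 _^ʳ_

_<ʳ_ : Cut → Cut → Set
x <ʳ y = ∃[ q ] Upper x q × Lower y q

fromℚ : ℚ → Cut
fromℚ p = record { Lower = ℚ._< p ; Upper = p ℚ.<_ }

ℕ→ℚ : ℕ → ℚ
ℕ→ℚ n = + n ℚ./ 1

fromℕ : ℕ → Cut
fromℕ n = fromℚ (ℕ→ℚ n)

_+ʳ_ : Cut → Cut → Cut
x +ʳ y = record
  { Lower = λ q → ∃[ a ] ∃[ b ] Lower x a × Lower y b × q ℚ.< a ℚ.+ b
  ; Upper = λ q → ∃[ a ] ∃[ b ] Upper x a × Upper y b × a ℚ.+ b ℚ.< q
  }

-ʳ_ : Cut → Cut
-ʳ x = record
  { Lower = λ q → Upper x (ℚ.- q)
  ; Upper = λ q → Lower x (ℚ.- q)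
  }

_-ʳ_ : Cut → Cut → Cut
x -ʳ y = x +ʳ (-ʳ y)

-- Interval multiplication, so no sign assumptions are needed.
_*ʳ_ : Cut → Cut → Cut
x *ʳ y = record
  { Lower = λ q → ∃[ a ] ∃[ b ] ∃[ c ] ∃[ d ] Enclosed a b c d
                × q ℚ.< ((a ℚ.* c) ℚ.⊓ (a ℚ.* d)) ℚ.⊓ ((b ℚ.* c) ℚ.⊓ (b ℚ.* d))
  ; Upper = λ q → ∃[ a ] ∃[ b ] ∃[ c ] ∃[ d ] Enclosed a b c d
                × ((a ℚ.* c) ℚ.⊔ (a ℚ.* d)) ℚ.⊔ ((b ℚ.* c) ℚ.⊔ (b ℚ.* d)) ℚ.< q
  }
  where
  Enclosed : ℚ → ℚ → ℚ → ℚ → Set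
  Enclosed a b c d = Lower x a × Upper x b × Lower y c × Upper y d

-- Correct for x > 0 only.
_⁻¹ʳ : Cut → Cut
x ⁻¹ʳ = record
  { Lower = λ q → ∃[ r ] Upper x r × q ℚ.* r ℚ.< 1ℚ
  ; Upper = λ q → ∃[ r ] 0ℚ ℚ.< r × Lower x r × 1ℚ ℚ.< q ℚ.* r
  }

-- n ^ʳ x is the real power n^x, for x > 0. It is squeezed between the
-- rational powers n^t, 0 < t < x, and n^t, t > x. For t = a/b > 0 and s ≥ 0,
-- the comparison of s with n^t is that of s^b with n^a.
_^ʳ_ : ℕ → Cut → Cut
n ^ʳ x = record
  { Lower = λ q → ∃[ t ] ∃[ s ] 0ℚ ℚ.< t × Lower x t × 0ℚ ℚ.≤ s
                × s ^ (↧ₙ t) ℚ.≤ ℕ→ℚ n ^ ℤ.∣ ↥ t ∣ × q ℚ.< s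
  ; Upper = λ q → ∃[ t ] ∃[ s ] 0ℚ ℚ.< t × Upper x t × 0ℚ ℚ.≤ s
                × ℕ→ℚ n ^ ℤ.∣ ↥ t ∣ ℚ.≤ s ^ (↧ₙ t) × s ℚ.< q
  }
  where open ℚ-Semiring using (_^_)

-- |j - x| < 1: every integer rounding of x, in particular floor and ceiling.
Rounds : ℕ → Cut → Set
Rounds j x = (fromℕ j <ʳ x +ʳ fromℕ 1) × (x <ʳ fromℕ j +ʳ fromℕ 1)

m-para : Cut → ℕ → Cut
m-para θ k = fromℕ 2 *ʳ ((fromℕ 1 -ʳ θ) *ʳ θ ⁻¹ʳ) *ʳ fromℕ k

Signal : ℕ → Set
Signal n = Vec (Fin 2) n

weight : ∀ {n} → Signal n → ℕ
weight σ = Vec.sum (Vec.map Fin.toℕ σ)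

-- A bipartite multigraph between m query-nodes (rows) and n entry-nodes
-- (columns), given by its edge multiplicities.
Multigraph : ℕ → ℕ → Set
Multigraph n m = Vec (Vec ℕ n) m

-- Γ successive draws of an entry for each of the m queries.
Draws : ℕ → ℕ → ℕ → Set
Draws n m Γ = Vec (Vec (Fin n) Γ) m

multigraph : ∀ {n m Γ} → Draws n m Γ → Multigraph n m
multigraph = Vec.map λ draw → Vec.tabulate λ i → Vec.count (i Fin.≟_) draw

results : ∀ {n m} → Multigraph n m → Signal n → Vec ℕ m
results G σ = Vec.map (λ a → Vec.sum (Vec.zipWith ℕ._*_ a (Vec.map Fin.toℕ σ))) G

vectors : ∀ {A : Set} → List A → ∀ n → List (Vec A n)
vectors xs zero    = [] List.∷ List.[]
vectors xs (suc n) = cartesianProductWith _∷_ xs (vectors xs n)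

signals : ∀ n k → List (Signal n)
signals n k = filter (λ σ → weight σ ℕ.≟ k) (vectors (allFin 2) n)

draws : ∀ n m Γ → List (Draws n m Γ)
draws n m Γ = vectors (vectors (allFin n) Γ) m

-- The uniform probability of P on a duplicate-free list of outcomes (with
-- value 0 on the empty list).
Pr : {Ω : Set} {P : Pred Ω 0ℓ} → List Ω → Decidable P → ℚ
Pr ωs P? = ratio (length (filter P? ωs)) (length ωs)
  where
  ratio : ℕ → ℕ → ℚ
  ratio a zero    = 0ℚ
  ratio a (suc b) = + a ℚ./ suc b

Decoder : ℕ → ℕ → Set
Decoder n m = Multigraph n m → Vec ℕ m → Signal n

-- Probability, over a uniform signal of weight k and independent uniform
-- draws, that the decoder outputs the signal.
Pr-success : ∀ n k m Γ → Decoder n m → ℚ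
Pr-success n k m Γ decode =
  Pr (cartesianProduct (signals n k) (draws n m Γ)) λ (σ , ω) →
    ≡-dec Fin._≟_ (decode (multigraph ω) (results (multigraph ω) σ)) σ

TendsToOne : (ℕ → ℚ) → Set
TendsToOne p = ∀ η → 0ℚ ℚ.< η → ∃[ N ] ∀ n → N ℕ.≤ n → ℚ.∣ p n ℚ.- 1ℚ ∣ ℚ.< η

module Submission where

-- The decoder returns some signal of weight k that is consistent with the
-- results, so it fails only if a second signal τ of weight k has the same
-- results as σ. Let d be the number of ones of σ outside τ. The contribution
-- of a query to the difference of the results of σ and τ is the end point of
-- a walk of Γ steps, each of which is ±1 with probability d/n each and 0
-- otherwise. Exchangeability of the steps gives
-- E|S| = (Γ + 1) (d/n) E(sgn (s + 1) - sgn (s - 1)) for the end point S after one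
-- more step s ↦ S, and E S² is explicit, whence P(s = 0) ≤ 1/√d, and also
-- P(s = 0) ≤ 3/4 for d ≥ 1.
--
-- A union bound finishes the proof. With d₀ = k^(1 - 1/r) for a large constant
-- r, at most (n + 1)^(2 d₀) signals τ have d ≤ d₀, each confused with σ with
-- probability at most (3/4)^m. All the others, at most (4 n/k)^k many, are
-- confused with σ with probability at most d₀^(-m/2). As m exceeds m-para by a
-- factor, d₀^(m/2) is (n/k)^((1 + δ) k) up to C^k factors for some δ > 0.

-- The factor 2 in `m-para` comes from the square root in the bound on P(s = 0): a query fails to
-- separate two distant signals with probability about k^(-1/2), so m queries gain k^(m/2), and this
-- must beat (n/k)^k = k^(k (1 - θ)/θ). The power of d decides the threshold and its constant does
-- not, which is why a second moment comparison is precise enough and no local limit theorem is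
-- called for. The obstacle is small d: there 1/√d is too weak (for d = 1 it says nothing), but such
-- τ are few. The cut d₀ must satisfy two demands: d₀ ln n is of smaller order than k, and ln d₀ is
-- within a factor close to 1 of ln k. A power of k just below k itself meets both. Logarithms and
-- real exponents never occur in the estimates. The exponent θ is enclosed between two neighbouring
-- rationals, and each estimate becomes an inequality of natural numbers after raising it to a
-- suitable power. The slack ε pays both for this enclosure and for the 1/r in the exponent of d₀.

open import Defs
open import Data.Bool using (true; false; if_then_else_)
open import Data.Fin as Fin using (Fin; zero; suc)
open import Data.Integer as ℤ using (ℤ; 0ℤ; 1ℤ; -1ℤ; -[1+_])
import Data.Integer.Properties as ℤₚ
import Data.Integer.Tactic.RingSolver as ℤ-Solver
open import Data.List as List using (List; []; _∷_; length; filter; map; allFin; cartesianProduct; cartesianProductWith)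
open import Data.List.Membership.Propositional using (_∈_; lose)
open import Data.List.Membership.Propositional.Properties using (∈-filter⁺; ∈-filter⁻; ∈-allFin; ∈-cartesianProductWith⁺)
import Data.List.Properties as Listₚ
open import Data.List.Relation.Unary.Any using (Any; here; there; any?)
open import Data.Nat as ℕ using (ℕ; zero; suc; _!; z≤n; s≤s; NonZero)
open import Data.Nat.ListAction using (sum)
import Data.Nat.Properties as ℕₚ
open import Data.Product using (∃; ∃-syntax; _×_; _,_; proj₁; proj₂)
open import Data.Rational as ℚ using (ℚ; 0ℚ; 1ℚ; ½; ↥_; ↧ₙ_)
import Data.Rational.Properties as ℚₚ
open import Data.Rational.Solver using (module +-*-Solver)
open import Data.Sum using (_⊎_; inj₁; inj₂; [_,_]′)
open import Data.Vec as Vec using (Vec; []; _∷_; lookup)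
import Data.Vec.Properties as Vecₚ
open import Data.Vec.Relation.Unary.All as All using (All; []; _∷_)
open import Function using (_∘_; id; Equivalence)
open import Level using (0ℓ)
open import Relation.Binary.Definitions using (tri<; tri≈; tri>)
open import Relation.Binary.PropositionalEquality
open import Relation.Nullary using (¬_; yes; no; does; ¬?; contradiction)
open import Relation.Nullary.Decidable using (_×-dec_)
open import Relation.Unary using (Pred; Decidable)

-- Return probability of the lazy walk.

module Anticoncentration where
  open import Data.Integer using (+_)
  open import Data.Nat using (_+_; _*_; _^_; _≤_; _<_)
  open import Data.Nat.Tactic.RingSolver using (solve-∀)

  sgn : ℤ → ℤ
  sgn (+ zero)  = 0ℤ
  sgn (+ suc _) = 1ℤ
  sgn -[1+ _ ]  = -1ℤ

  isZero : ℤ → ℤ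
  isZero (+ zero)  = 1ℤ
  isZero (+ suc _) = 0ℤ
  isZero -[1+ _ ]  = 0ℤ

  isZero-nonneg : ∀ s → 0ℤ ℤ.≤ isZero s
  isZero-nonneg (+ zero)  = ℤ.+≤+ ℕ.z≤n
  isZero-nonneg (+ suc _) = ℤ.+≤+ ℕ.z≤n
  isZero-nonneg -[1+ _ ]  = ℤ.+≤+ ℕ.z≤n

  -- The central difference of `sgn` is 2 at 0, 1 at ±1 and 0 elsewhere. With `g = sgn`,
  -- `E-size-bias` thereby turns the first absolute moment into an upper estimate of the returns to
  -- 0.
  sgn-increment : ∀ s → + 2 ℤ.* isZero s ℤ.≤ sgn (ℤ.suc s) ℤ.+ ℤ.- sgn (ℤ.pred s)
  sgn-increment (+ zero)        = ℤₚ.≤-refl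
  sgn-increment (+ 1)           = ℤ.+≤+ ℕ.z≤n
  sgn-increment (+ suc (suc _)) = ℤ.+≤+ ℕ.z≤n
  sgn-increment -[1+ zero ]     = ℤ.+≤+ ℕ.z≤n
  sgn-increment -[1+ suc _ ]    = ℤ.+≤+ ℕ.z≤n

  sgn² : ∀ s → sgn s ℤ.* sgn s ≡ 1ℤ ℤ.- isZero s
  sgn² (+ zero)  = refl
  sgn² (+ suc _) = refl
  sgn² -[1+ _ ]  = refl

  +-cancelˡ-≤ : ∀ i {j k} → i ℤ.+ j ℤ.≤ i ℤ.+ k → j ℤ.≤ k
  +-cancelˡ-≤ i {j} {k} ij≤ik = subst₂ ℤ._≤_ (ring i j) (ring i k) (ℤₚ.+-monoʳ-≤ (ℤ.- i) ij≤ik)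
    where
    ring : ∀ i j → ℤ.- i ℤ.+ (i ℤ.+ j) ≡ j
    ring = ℤ-Solver.solve-∀

  square-nonneg : ∀ i → 0ℤ ℤ.≤ i ℤ.* i
  square-nonneg (+ n)    = subst (0ℤ ℤ.≤_) (ℤₚ.pos-* n n) (ℤ.+≤+ ℕ.z≤n)
  square-nonneg -[1+ n ] = ℤ.+≤+ ℕ.z≤n

  module LazyWalk (α d : ℕ) where

    -- The sum of f over the end points of all walks of Γ steps from 0, where
    -- α of the steps stand still, d go up and d go down.
    E : ℕ → (ℤ → ℤ) → ℤ
    E zero    f = f 0ℤ
    E (suc Γ) f = + α ℤ.* E Γ f ℤ.+ + d ℤ.* (E Γ (f ∘ ℤ.suc) ℤ.+ E Γ (f ∘ ℤ.pred))

    steps : ℕ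
    steps = α ℕ.+ (d ℕ.+ d)

    E-cong : ∀ Γ {f g} → (∀ s → f s ≡ g s) → E Γ f ≡ E Γ g
    E-cong zero    f≗g = f≗g 0ℤ
    E-cong (suc Γ) f≗g = cong₂ (λ x y → + α ℤ.* x ℤ.+ + d ℤ.* y) (E-cong Γ f≗g)
      (cong₂ ℤ._+_ (E-cong Γ (f≗g ∘ ℤ.suc)) (E-cong Γ (f≗g ∘ ℤ.pred)))

    E-mono : ∀ Γ {f g} → (∀ s → f s ℤ.≤ g s) → E Γ f ℤ.≤ E Γ g
    E-mono zero    f≤g = f≤g 0ℤ
    E-mono (suc Γ) f≤g = ℤₚ.+-mono-≤
      (ℤₚ.*-monoˡ-≤-nonNeg (+ α) (E-mono Γ f≤g))
      (ℤₚ.*-monoˡ-≤-nonNeg (+ d)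
        (ℤₚ.+-mono-≤ (E-mono Γ (f≤g ∘ ℤ.suc)) (E-mono Γ (f≤g ∘ ℤ.pred))))

    E-linear : ∀ Γ a b {f g} →
      E Γ (λ s → a ℤ.* f s ℤ.+ b ℤ.* g s) ≡ a ℤ.* E Γ f ℤ.+ b ℤ.* E Γ g
    E-linear zero    a b = refl
    E-linear (suc Γ) a b {f} {g}
      rewrite E-linear Γ a b {f} {g}
            | E-linear Γ a b {f ∘ ℤ.suc} {g ∘ ℤ.suc}
            | E-linear Γ a b {f ∘ ℤ.pred} {g ∘ ℤ.pred}
      = ring (+ α) (+ d) a b _ _ _ _ _ _
      where
      ring : ∀ α d a b f f₊ f₋ g g₊ g₋ →
        α ℤ.* (a ℤ.* f ℤ.+ b ℤ.* g)
          ℤ.+ d ℤ.* ((a ℤ.* f₊ ℤ.+ b ℤ.* g₊) ℤ.+ (a ℤ.* f₋ ℤ.+ b ℤ.* g₋))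
        ≡ a ℤ.* (α ℤ.* f ℤ.+ d ℤ.* (f₊ ℤ.+ f₋)) ℤ.+ b ℤ.* (α ℤ.* g ℤ.+ d ℤ.* (g₊ ℤ.+ g₋))
      ring = ℤ-Solver.solve-∀

    E-const : ∀ Γ c → E Γ (λ _ → c) ≡ c ℤ.* + (steps ℕ.^ Γ)
    E-const zero    c = sym (ℤₚ.*-identityʳ c)
    E-const (suc Γ) c = trans (cong (λ x → + α ℤ.* x ℤ.+ + d ℤ.* (x ℤ.+ x)) (E-const Γ c))
      (trans (ring (+ α) (+ d) c (+ (steps ℕ.^ Γ)))
        (cong (c ℤ.*_) (sym (ℤₚ.pos-* steps (steps ℕ.^ Γ)))))
      where
      ring : ∀ α d c M → α ℤ.* (c ℤ.* M) ℤ.+ d ℤ.* (c ℤ.* M ℤ.+ c ℤ.* M)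
                       ≡ c ℤ.* ((α ℤ.+ (d ℤ.+ d)) ℤ.* M)
      ring = ℤ-Solver.solve-∀

    D : ℕ → (ℤ → ℤ) → ℤ
    D Γ g = E Γ (λ s → g (ℤ.suc s) ℤ.+ ℤ.- g (ℤ.pred s))

    D-split : ∀ Γ g → D Γ g ≡ E Γ (g ∘ ℤ.suc) ℤ.- E Γ (g ∘ ℤ.pred)
    D-split Γ g = trans (E-cong Γ λ s → ring₁ (g (ℤ.suc s)) (g (ℤ.pred s)))
      (trans (E-linear Γ 1ℤ -1ℤ {g ∘ ℤ.suc} {g ∘ ℤ.pred}) (sym (ring₁ (E Γ (g ∘ ℤ.suc)) (E Γ (g ∘ ℤ.pred)))))
      where
      ring₁ : ∀ x y → x ℤ.- y ≡ 1ℤ ℤ.* x ℤ.+ -1ℤ ℤ.* y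
      ring₁ = ℤ-Solver.solve-∀

    -- By exchangeability of the steps, the end point may be replaced by
    -- suc Γ times the last step.
    E-size-bias : ∀ Γ g → E (suc Γ) (λ s → s ℤ.* g s) ≡ + (suc Γ) ℤ.* + d ℤ.* D Γ g
    E-size-bias zero g = ring (+ α) (+ d) (g 0ℤ) (g 1ℤ) (g -1ℤ)
      where
      ring : ∀ α d g g₊ g₋ → α ℤ.* (0ℤ ℤ.* g) ℤ.+ d ℤ.* (1ℤ ℤ.* g₊ ℤ.+ -1ℤ ℤ.* g₋)
                           ≡ 1ℤ ℤ.* d ℤ.* (g₊ ℤ.+ ℤ.- g₋)
      ring = ℤ-Solver.solve-∀
    E-size-bias (suc Γ) g = begin
      + α ℤ.* E (suc Γ) (λ s → s ℤ.* g s)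
        ℤ.+ + d ℤ.* (E (suc Γ) (λ s → ℤ.suc s ℤ.* g (ℤ.suc s)) ℤ.+ E (suc Γ) (λ s → ℤ.pred s ℤ.* g (ℤ.pred s)))
        ≡⟨ cong₂ (λ x y → + α ℤ.* E (suc Γ) (λ s → s ℤ.* g s) ℤ.+ + d ℤ.* (x ℤ.+ y))
             (trans (E-cong (suc Γ) λ s → shift 1ℤ s (g (ℤ.suc s))) (E-linear (suc Γ) 1ℤ 1ℤ))
             (trans (E-cong (suc Γ) λ s → shift -1ℤ s (g (ℤ.pred s))) (E-linear (suc Γ) 1ℤ -1ℤ)) ⟩
      + α ℤ.* E (suc Γ) (λ s → s ℤ.* g s)
        ℤ.+ + d ℤ.* ((1ℤ ℤ.* E (suc Γ) (λ s → s ℤ.* g (ℤ.suc s)) ℤ.+ 1ℤ ℤ.* E (suc Γ) (g ∘ ℤ.suc))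
                     ℤ.+ (1ℤ ℤ.* E (suc Γ) (λ s → s ℤ.* g (ℤ.pred s)) ℤ.+ -1ℤ ℤ.* E (suc Γ) (g ∘ ℤ.pred)))
        ≡⟨ cong₂ (λ x y → + α ℤ.* x ℤ.+ + d ℤ.* y) (ih g)
             (cong₂ (λ x y → (1ℤ ℤ.* x ℤ.+ 1ℤ ℤ.* E (suc Γ) (g ∘ ℤ.suc)) ℤ.+ (1ℤ ℤ.* y ℤ.+ -1ℤ ℤ.* E (suc Γ) (g ∘ ℤ.pred)))
                (ih (g ∘ ℤ.suc))
                (ih (g ∘ ℤ.pred))) ⟩
      _ ≡⟨ algebra (+ α) (+ d) N A₊ A₋ A₊₊ A₋₋ up-down ⟩
      + suc (suc Γ) ℤ.* + d ℤ.* (E (suc Γ) (g ∘ ℤ.suc) ℤ.- E (suc Γ) (g ∘ ℤ.pred))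
        ≡⟨ cong (+ suc (suc Γ) ℤ.* + d ℤ.*_) (sym (D-split (suc Γ) g)) ⟩
      + suc (suc Γ) ℤ.* + d ℤ.* D (suc Γ) g ∎
      where
      open ≡-Reasoning
      N A₊ A₋ A₊₊ A₊₋ A₋₊ A₋₋ : ℤ
      N   = + suc Γ
      A₊  = E Γ (g ∘ ℤ.suc)
      A₋  = E Γ (g ∘ ℤ.pred)
      A₊₊ = E Γ (g ∘ ℤ.suc ∘ ℤ.suc)
      A₊₋ = E Γ (g ∘ ℤ.suc ∘ ℤ.pred)
      A₋₊ = E Γ (g ∘ ℤ.pred ∘ ℤ.suc)
      A₋₋ = E Γ (g ∘ ℤ.pred ∘ ℤ.pred)
      ih : ∀ h → E (suc Γ) (λ s → s ℤ.* h s) ≡ N ℤ.* + d ℤ.* (E Γ (h ∘ ℤ.suc) ℤ.- E Γ (h ∘ ℤ.pred))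
      ih h = trans (E-size-bias Γ h) (cong (N ℤ.* + d ℤ.*_) (D-split Γ h))
      up-down : A₊₋ ≡ A₋₊
      up-down = E-cong Γ λ s → cong g (trans (ℤₚ.suc-pred s) (sym (ℤₚ.pred-suc s)))
      shift : ∀ e s x → (e ℤ.+ s) ℤ.* x ≡ 1ℤ ℤ.* (s ℤ.* x) ℤ.+ e ℤ.* x
      shift = ℤ-Solver.solve-∀
      -- Up and down steps commute, so the two mixed second shifts of `g` have the same sum.
      -- Matching on this equation leaves a single variable for both, after which the induction step
      -- is a ring identity.
      algebra : ∀ α d N A₊ A₋ A₊₊ A₋₋ {A₊₋ A₋₊} → A₊₋ ≡ A₋₊ →
        α ℤ.* (N ℤ.* d ℤ.* (A₊ ℤ.- A₋))
          ℤ.+ d ℤ.* ((1ℤ ℤ.* (N ℤ.* d ℤ.* (A₊₊ ℤ.- A₊₋)) ℤ.+ 1ℤ ℤ.* (α ℤ.* A₊ ℤ.+ d ℤ.* (A₊₊ ℤ.+ A₊₋)))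
                     ℤ.+ (1ℤ ℤ.* (N ℤ.* d ℤ.* (A₋₊ ℤ.- A₋₋)) ℤ.+ -1ℤ ℤ.* (α ℤ.* A₋ ℤ.+ d ℤ.* (A₋₊ ℤ.+ A₋₋))))
        ≡ (1ℤ ℤ.+ N) ℤ.* d ℤ.* ((α ℤ.* A₊ ℤ.+ d ℤ.* (A₊₊ ℤ.+ A₊₋)) ℤ.- (α ℤ.* A₋ ℤ.+ d ℤ.* (A₋₊ ℤ.+ A₋₋)))
      algebra α d N A₊ A₋ A₊₊ A₋₋ {A} refl = ring α d N A₊ A₋ A₊₊ A₋₋ A
        where
        ring : ∀ α d N A₊ A₋ A₊₊ A₋₋ A →
          α ℤ.* (N ℤ.* d ℤ.* (A₊ ℤ.- A₋))
            ℤ.+ d ℤ.* ((1ℤ ℤ.* (N ℤ.* d ℤ.* (A₊₊ ℤ.- A)) ℤ.+ 1ℤ ℤ.* (α ℤ.* A₊ ℤ.+ d ℤ.* (A₊₊ ℤ.+ A)))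
                       ℤ.+ (1ℤ ℤ.* (N ℤ.* d ℤ.* (A ℤ.- A₋₋)) ℤ.+ -1ℤ ℤ.* (α ℤ.* A₋ ℤ.+ d ℤ.* (A ℤ.+ A₋₋))))
          ≡ (1ℤ ℤ.+ N) ℤ.* d ℤ.* ((α ℤ.* A₊ ℤ.+ d ℤ.* (A₊₊ ℤ.+ A)) ℤ.- (α ℤ.* A₋ ℤ.+ d ℤ.* (A ℤ.+ A₋₋)))
        ring = ℤ-Solver.solve-∀

    -- The sum of (w s - M sgn s)² over the end points s after suc Γ steps is
    -- nonnegative, and E-size-bias evaluates its mixed term.
    private
      second-moment : ∀ Γ w → + w ≡ E Γ isZero → let M = + (steps ℕ.^ Γ); N = + suc Γ in
        M ℤ.* (+ 2 ℤ.* N ℤ.* + d ℤ.* (+ w ℤ.* + w) ℤ.+ + α ℤ.* (M ℤ.* + w))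
          ℤ.≤ M ℤ.* (+ steps ℤ.* (M ℤ.* M))
      second-moment Γ w w≡ = +-cancelˡ-≤ (a ℤ.* (N ℤ.* + d ℤ.* + w)) (begin
        a ℤ.* (N ℤ.* + d ℤ.* + w) ℤ.+ M ℤ.* (+ 2 ℤ.* N ℤ.* + d ℤ.* (+ w ℤ.* + w) ℤ.+ + α ℤ.* (M ℤ.* + w))
          ≡⟨ ring₁ (+ α) (+ d) N M (+ w) ⟩
        a ℤ.* (N ℤ.* + d ℤ.* (+ 2 ℤ.* + w)) ℤ.+ b ℤ.* (+ α ℤ.* + w)
          ≤⟨ ℤₚ.+-mono-≤ (ℤₚ.*-monoˡ-≤-nonNeg a {{a≥0}} (ℤₚ.*-monoˡ-≤-nonNeg (N ℤ.* + d) {{Nd≥0}} mixed))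
                        (ℤₚ.*-monoˡ-≤-nonNeg b {{b≥0}} returns) ⟩
        a ℤ.* (N ℤ.* + d ℤ.* D Γ sgn) ℤ.+ b ℤ.* E (suc Γ) isZero
          ≡⟨ cong (λ x → a ℤ.* x ℤ.+ b ℤ.* E (suc Γ) isZero) (E-size-bias Γ sgn) ⟨
        a ℤ.* E (suc Γ) (λ s → s ℤ.* sgn s) ℤ.+ b ℤ.* E (suc Γ) isZero
          ≡⟨ E-linear (suc Γ) a b ⟨
        E (suc Γ) (λ s → a ℤ.* (s ℤ.* sgn s) ℤ.+ b ℤ.* isZero s)
          ≤⟨ E-mono (suc Γ) pointwise ⟩
        E (suc Γ) (λ s → + w ℤ.* + w ℤ.* (s ℤ.* s) ℤ.+ b ℤ.* 1ℤ)
          ≡⟨ E-linear (suc Γ) (+ w ℤ.* + w) b ⟩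
        + w ℤ.* + w ℤ.* E (suc Γ) (λ s → s ℤ.* s) ℤ.+ b ℤ.* E (suc Γ) (λ _ → 1ℤ)
          ≡⟨ cong₂ (λ x y → + w ℤ.* + w ℤ.* x ℤ.+ b ℤ.* y)
               (trans (E-size-bias Γ (λ s → s)) (cong (N ℤ.* + d ℤ.*_)
                 (trans (E-cong Γ two) (E-const Γ (+ 2)))))
               (trans (E-const (suc Γ) 1ℤ) (cong (1ℤ ℤ.*_) (ℤₚ.pos-* steps (steps ℕ.^ Γ)))) ⟩
        + w ℤ.* + w ℤ.* (N ℤ.* + d ℤ.* (+ 2 ℤ.* M)) ℤ.+ b ℤ.* (1ℤ ℤ.* (+ steps ℤ.* M))
          ≡⟨ ring₂ (+ steps) (+ d) N M (+ w) ⟩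
        a ℤ.* (N ℤ.* + d ℤ.* + w) ℤ.+ M ℤ.* (+ steps ℤ.* (M ℤ.* M)) ∎)
        where
        open ℤₚ.≤-Reasoning
        M N a b : ℤ
        M = + (steps ℕ.^ Γ)
        N = + suc Γ
        a = + 2 ℤ.* (+ w ℤ.* M)
        b = M ℤ.* M
        nonNeg-* : ∀ i j → .{{ℤ.NonNegative i}} → .{{ℤ.NonNegative j}} → ℤ.NonNegative (i ℤ.* j)
        nonNeg-* (+ i) (+ j) = subst ℤ.NonNegative (ℤₚ.pos-* i j) _
        a≥0 : ℤ.NonNegative a
        a≥0 = nonNeg-* (+ 2) (+ w ℤ.* M) {{_}} {{nonNeg-* (+ w) M}}
        b≥0 : ℤ.NonNegative b
        b≥0 = nonNeg-* M M
        Nd≥0 : ℤ.NonNegative (N ℤ.* + d)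
        Nd≥0 = nonNeg-* N (+ d)
        mixed : + 2 ℤ.* + w ℤ.≤ D Γ sgn
        mixed = begin
          + 2 ℤ.* + w                                     ≡⟨ cong (+ 2 ℤ.*_) w≡ ⟩
          + 2 ℤ.* E Γ isZero                              ≡⟨ ℤₚ.+-identityʳ _ ⟨
          + 2 ℤ.* E Γ isZero ℤ.+ 0ℤ ℤ.* E Γ isZero        ≡⟨ E-linear Γ (+ 2) 0ℤ {isZero} {isZero} ⟨
          E Γ (λ s → + 2 ℤ.* isZero s ℤ.+ 0ℤ ℤ.* isZero s) ≡⟨ E-cong Γ (λ s → ℤₚ.+-identityʳ (+ 2 ℤ.* isZero s)) ⟩
          E Γ (λ s → + 2 ℤ.* isZero s)                    ≤⟨ E-mono Γ sgn-increment ⟩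
          D Γ sgn ∎
        E-nonneg : ∀ {f} → (∀ s → 0ℤ ℤ.≤ f s) → 0ℤ ℤ.≤ E Γ f
        E-nonneg {f} f≥0 = subst (ℤ._≤ E Γ f) (E-const Γ 0ℤ) (E-mono Γ {λ _ → 0ℤ} {f} f≥0)
        -- Returns after the extra step are kept because `sgn` vanishes there; a walk already at 0
        -- may stand still. This yields the term with `α`, which later rescues the case d = 1.
        returns : + α ℤ.* + w ℤ.≤ E (suc Γ) isZero
        returns = begin
          + α ℤ.* + w                 ≡⟨ cong (+ α ℤ.*_) w≡ ⟩
          + α ℤ.* E Γ isZero          ≡⟨ ℤₚ.+-identityʳ _ ⟨
          + α ℤ.* E Γ isZero ℤ.+ 0ℤ   ≡⟨ cong (λ x → + α ℤ.* E Γ isZero ℤ.+ x) (sym (ℤₚ.*-zeroʳ (+ d))) ⟩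
          + α ℤ.* E Γ isZero ℤ.+ + d ℤ.* 0ℤ
            ≤⟨ ℤₚ.+-monoʳ-≤ (+ α ℤ.* E Γ isZero) (ℤₚ.*-monoˡ-≤-nonNeg (+ d)
                 (ℤₚ.+-mono-≤ (E-nonneg (isZero-nonneg ∘ ℤ.suc)) (E-nonneg (isZero-nonneg ∘ ℤ.pred)))) ⟩
          E (suc Γ) isZero ∎
        two : ∀ s → ℤ.suc s ℤ.+ ℤ.- ℤ.pred s ≡ + 2
        two = ring
          where
          ring : ∀ s → (1ℤ ℤ.+ s) ℤ.+ ℤ.- (-1ℤ ℤ.+ s) ≡ + 2
          ring = ℤ-Solver.solve-∀
        -- For the end point S the quadratic λ² E S² - 2 λ E|S| + P(S ≠ 0) is least at λ = E|S| / E
        -- S². With the lower bound `mixed` in place of the first moment this ratio is w/M, whence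
        -- the coefficients `w` and `M`.
        pointwise : ∀ s → a ℤ.* (s ℤ.* sgn s) ℤ.+ b ℤ.* isZero s ℤ.≤ + w ℤ.* + w ℤ.* (s ℤ.* s) ℤ.+ b ℤ.* 1ℤ
        pointwise s = ℤₚ.0≤i-j⇒j≤i (subst (0ℤ ℤ.≤_)
          (trans (ring (+ w) M s (sgn s)) (trans (cong (λ x → + w ℤ.* + w ℤ.* (s ℤ.* s) ℤ.- a ℤ.* (s ℤ.* sgn s) ℤ.+ b ℤ.* x) (sgn² s)) (ring′ (+ w ℤ.* + w ℤ.* (s ℤ.* s)) (a ℤ.* (s ℤ.* sgn s)) b (isZero s))))
          (square-nonneg (+ w ℤ.* s ℤ.- M ℤ.* sgn s)))
          where
          ring : ∀ w M s t → (w ℤ.* s ℤ.- M ℤ.* t) ℤ.* (w ℤ.* s ℤ.- M ℤ.* t)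
            ≡ w ℤ.* w ℤ.* (s ℤ.* s) ℤ.- + 2 ℤ.* (w ℤ.* M) ℤ.* (s ℤ.* t) ℤ.+ M ℤ.* M ℤ.* (t ℤ.* t)
          ring = ℤ-Solver.solve-∀
          ring′ : ∀ x y b z → x ℤ.- y ℤ.+ b ℤ.* (1ℤ ℤ.- z) ≡ x ℤ.+ b ℤ.* 1ℤ ℤ.- (y ℤ.+ b ℤ.* z)
          ring′ = ℤ-Solver.solve-∀
        ring₁ : ∀ α d N M w → + 2 ℤ.* (w ℤ.* M) ℤ.* (N ℤ.* d ℤ.* w)
            ℤ.+ M ℤ.* (+ 2 ℤ.* N ℤ.* d ℤ.* (w ℤ.* w) ℤ.+ α ℤ.* (M ℤ.* w))
          ≡ + 2 ℤ.* (w ℤ.* M) ℤ.* (N ℤ.* d ℤ.* (+ 2 ℤ.* w)) ℤ.+ M ℤ.* M ℤ.* (α ℤ.* w)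
        ring₁ = ℤ-Solver.solve-∀
        ring₂ : ∀ n d N M w → w ℤ.* w ℤ.* (N ℤ.* d ℤ.* (+ 2 ℤ.* M)) ℤ.+ M ℤ.* M ℤ.* (1ℤ ℤ.* (n ℤ.* M))
          ≡ + 2 ℤ.* (w ℤ.* M) ℤ.* (N ℤ.* d ℤ.* w) ℤ.+ M ℤ.* (n ℤ.* (M ℤ.* M))
        ring₂ = ℤ-Solver.solve-∀

    -- With p = w/M and n = `steps` the conclusion reads d p² + (α/n) p ≤ 1. The size of the queries
    -- enters here: the variance 2 (Γ + 1) d/n of the end point is at least d when n ≤ 2 (Γ + 1).
    anticoncentration : ∀ Γ w .{{_ : ℕ.NonZero steps}} → + w ≡ E Γ isZero → steps ℕ.≤ 2 ℕ.* suc Γ →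
      let M = steps ℕ.^ Γ in
      steps ℕ.* d ℕ.* (w ℕ.* w) ℕ.+ α ℕ.* (M ℕ.* w) ℕ.≤ steps ℕ.* (M ℕ.* M)
    anticoncentration Γ w w≡ n≤2Γ+2 = ℕₚ.≤-trans
      (ℕₚ.+-monoˡ-≤ _ (ℕₚ.*-monoˡ-≤ (w ℕ.* w) (ℕₚ.*-monoˡ-≤ d n≤2Γ+2)))
      (ℕₚ.*-cancelˡ-≤ M {{ℕₚ.m^n≢0 steps Γ}} (ℤₚ.drop‿+≤+ (subst₂ ℤ._≤_ lhs rhs (second-moment Γ w w≡))))
      where
      M : ℕ
      M = steps ℕ.^ Γ
      pos³ : ∀ x y z → + x ℤ.* (+ y ℤ.* + z) ≡ + (x ℕ.* (y ℕ.* z))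
      pos³ x y z = trans (cong (+ x ℤ.*_) (sym (ℤₚ.pos-* y z))) (sym (ℤₚ.pos-* x (y ℕ.* z)))
      lhs : + M ℤ.* (+ 2 ℤ.* + suc Γ ℤ.* + d ℤ.* (+ w ℤ.* + w) ℤ.+ + α ℤ.* (+ M ℤ.* + w))
          ≡ + (M ℕ.* (2 ℕ.* suc Γ ℕ.* d ℕ.* (w ℕ.* w) ℕ.+ α ℕ.* (M ℕ.* w)))
      lhs = trans (cong (+ M ℤ.*_) (cong₂ ℤ._+_
          (trans (cong (ℤ._* (+ w ℤ.* + w)) (sym (ℤₚ.pos-* (2 ℕ.* suc Γ) d))) (pos³ (2 ℕ.* suc Γ ℕ.* d) w w))
          (pos³ α M w)))
        (sym (ℤₚ.pos-* M _))
      rhs : + M ℤ.* (+ steps ℤ.* (+ M ℤ.* + M)) ≡ + (M ℕ.* (steps ℕ.* (M ℕ.* M)))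
      rhs = trans (cong (+ M ℤ.*_) (pos³ steps M M)) (sym (ℤₚ.pos-* M _))

  module _ (α d : ℕ) where
    open LazyWalk α d

    -- This is d p² + (α/n) p ≥ 1 at p = 3/4, multiplied by 16 n. For d ≥ 2 the first term suffices,
    -- as 9 d ≥ 18. For d = 1 one has α = n - 2 and needs 21 n - 24 ≥ 16 n, which is the origin of
    -- the condition n ≥ 5.
    quadratic : 1 ≤ d → 5 ≤ steps → 16 * steps ≤ 9 * (steps * d) + 12 * α
    quadratic = go d
      where
      go : ∀ d → 1 ≤ d → 5 ≤ α + (d + d) → 16 * (α + (d + d)) ≤ 9 * ((α + (d + d)) * d) + 12 * α
      go (suc zero) _ n≥5 with ℕₚ.m≤n⇒∃[o]m+o≡n (ℕₚ.+-cancelʳ-≤ 2 3 α n≥5)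
      ... | o , refl = ℕₚ.m+n≤o⇒m≤o _ (ℕₚ.≤-reflexive (ring o))
        where
        ring : ∀ o → 16 * ((3 + o) + 2) + (1 + 5 * o) ≡ 9 * (((3 + o) + 2) * 1) + 12 * (3 + o)
        ring = solve-∀
      go (suc (suc e)) _ _ = ℕₚ.m+n≤o⇒m≤o _ (ℕₚ.≤-reflexive (ring α e))
        where
        ring : ∀ α e → 16 * (α + (2 + e + (2 + e))) + (2 * (α + (2 + e + (2 + e))) + 9 * ((α + (2 + e + (2 + e))) * e) + 12 * α)
          ≡ 9 * ((α + (2 + e + (2 + e))) * (2 + e)) + 12 * α
        ring = solve-∀

    module _ {Γ w : ℕ} .{{_ : NonZero steps}} (w≡ : + w ≡ E Γ isZero) (n≤2Γ+2 : steps ≤ 2 * suc Γ) where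

      private
        M : ℕ
        M = steps ^ Γ

        bound : steps * d * (w * w) + α * (M * w) ≤ steps * (M * M)
        bound = anticoncentration Γ w w≡ n≤2Γ+2

      return-bound : d * (w * w) ≤ M * M
      return-bound = ℕₚ.*-cancelˡ-≤ steps (ℕₚ.≤-trans (ℕₚ.≤-reflexive (sym (ℕₚ.*-assoc steps d (w * w))))
        (ℕₚ.m+n≤o⇒m≤o _ bound))

      -- For d = 1 the first term of the bound alone yields only w ≤ M; the
      -- second one gives the constant.
      return-bound-constant : 1 ≤ d → 5 ≤ steps → 4 * w ≤ 3 * M
      return-bound-constant d≥1 n≥5 with 4 * w ℕₚ.≤? 3 * M
      ... | yes 4w≤3M = 4w≤3M
      ... | no  4w≰3M = contradiction (ℕₚ.*-cancelʳ-< (M * M) _ _ strictly) (ℕₚ.≤⇒≯ (quadratic d≥1 n≥5))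
        where
        open ℕₚ.≤-Reasoning
        3M<4w : 3 * M < 4 * w
        3M<4w = ℕₚ.≰⇒> 4w≰3M
        instance
          M*M≢0 : NonZero (M * M)
          M*M≢0 = ℕₚ.m*n≢0 M M {{ℕₚ.m^n≢0 steps Γ}} {{ℕₚ.m^n≢0 steps Γ}}
          d≢0 : NonZero d
          d≢0 = ℕ.>-nonZero d≥1
          nd≢0 : NonZero (steps * d)
          nd≢0 = ℕₚ.m*n≢0 steps d
        strictly : (9 * (steps * d) + 12 * α) * (M * M) < 16 * steps * (M * M)
        strictly = begin-strict
          (9 * (steps * d) + 12 * α) * (M * M)
            ≡⟨ ring₁ (steps * d) α M ⟩
          steps * d * (3 * M * (3 * M)) + 4 * α * M * (3 * M)
            <⟨ ℕₚ.+-mono-<-≤ (ℕₚ.*-monoʳ-< (steps * d) (ℕₚ.*-mono-< 3M<4w 3M<4w))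
                             (ℕₚ.*-monoʳ-≤ (4 * α * M) (ℕₚ.<⇒≤ 3M<4w)) ⟩
          steps * d * (4 * w * (4 * w)) + 4 * α * M * (4 * w)
            ≡⟨ ring₂ (steps * d) α M w ⟩
          16 * (steps * d * (w * w) + α * (M * w))
            ≤⟨ ℕₚ.*-monoʳ-≤ 16 bound ⟩
          16 * (steps * (M * M))
            ≡⟨ ℕₚ.*-assoc 16 steps (M * M) ⟨
          16 * steps * (M * M) ∎
          where
          ring₁ : ∀ x α M → (9 * x + 12 * α) * (M * M) ≡ x * (3 * M * (3 * M)) + 4 * α * M * (3 * M)
          ring₁ = solve-∀
          ring₂ : ∀ x α M w → x * (4 * w * (4 * w)) + 4 * α * M * (4 * w) ≡ 16 * (x * (w * w) + α * (M * w))
          ring₂ = solve-∀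

-- Counting signals, and the drift of a query as a lazy walk.

module Counting where
  open Anticoncentration
  open import Data.Nat using (_+_; _*_; _^_; _≤_; _<_)
  open import Data.Nat.Tactic.RingSolver using (solve-∀)

  private variable
    A B C : Set

  count : {P : Pred A 0ℓ} → Decidable P → List A → ℕ
  count P? xs = length (filter P? xs)

  ∑ : List A → (A → ℕ) → ℕ
  ∑ xs f = sum (map f xs)

  count-mono : {P Q : Pred A 0ℓ} (P? : Decidable P) (Q? : Decidable Q) → (∀ x → P x → Q x) →
    ∀ xs → count P? xs ≤ count Q? xs
  count-mono P? Q? P⊆Q [] = z≤n
  count-mono P? Q? P⊆Q (x ∷ xs) with P? x | Q? x
  ... | yes p | yes q = s≤s (count-mono P? Q? P⊆Q xs)
  ... | yes p | no ¬q = contradiction (P⊆Q x p) ¬q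
  ... | no _  | yes q = ℕₚ.m≤n⇒m≤1+n (count-mono P? Q? P⊆Q xs)
  ... | no _  | no _  = count-mono P? Q? P⊆Q xs

  count-cong : {P Q : Pred A 0ℓ} (P? : Decidable P) (Q? : Decidable Q) → (∀ x → P x → Q x) → (∀ x → Q x → P x) →
    ∀ xs → count P? xs ≡ count Q? xs
  count-cong P? Q? P⊆Q Q⊆P xs = ℕₚ.≤-antisym (count-mono P? Q? P⊆Q xs) (count-mono Q? P? Q⊆P xs)

  count-⊎ : {P Q R : Pred A 0ℓ} (P? : Decidable P) (Q? : Decidable Q) (R? : Decidable R) → (∀ x → P x → Q x ⊎ R x) →
    ∀ xs → count P? xs ≤ count Q? xs + count R? xs
  count-⊎ P? Q? R? P⊆Q⊎R [] = z≤n
  count-⊎ P? Q? R? P⊆Q⊎R (x ∷ xs) with P? x | Q? x | R? x | count-⊎ P? Q? R? P⊆Q⊎R xs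
  ... | yes p | no ¬q | no ¬r | _  = contradiction (P⊆Q⊎R x p) [ ¬q , ¬r ]′
  ... | yes p | yes q | no _  | ih = s≤s ih
  ... | yes p | yes q | yes r | ih = s≤s (ℕₚ.≤-trans ih (ℕₚ.+-monoʳ-≤ _ (ℕₚ.n≤1+n _)))
  ... | yes p | no _  | yes r | ih = ℕₚ.≤-trans (s≤s ih) (ℕₚ.≤-reflexive (sym (ℕₚ.+-suc _ _)))
  ... | no _  | no _  | no _  | ih = ih
  ... | no _  | yes q | no _  | ih = ℕₚ.m≤n⇒m≤1+n ih
  ... | no _  | yes q | yes r | ih = ℕₚ.m≤n⇒m≤1+n (ℕₚ.≤-trans ih (ℕₚ.+-monoʳ-≤ _ (ℕₚ.n≤1+n _)))
  ... | no _  | no _  | yes r | ih = ℕₚ.≤-trans ih (ℕₚ.+-monoʳ-≤ _ (ℕₚ.n≤1+n _))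

  count-empty : {P : Pred A 0ℓ} (P? : Decidable P) → (∀ x → ¬ P x) → ∀ xs → count P? xs ≡ 0
  count-empty P? ¬P [] = refl
  count-empty P? ¬P (x ∷ xs) with P? x
  ... | yes p = contradiction p (¬P x)
  ... | no _  = count-empty P? ¬P xs

  count-union : {P : Pred B 0ℓ} {Q : A → Pred B 0ℓ} (P? : Decidable P) (Q? : ∀ x → Decidable (Q x)) →
    ∀ xs → (∀ y → P y → Any (λ x → Q x y) xs) →
    ∀ ys → count P? ys ≤ ∑ xs (λ x → count (Q? x) ys)
  count-union P? Q? [] P⊆ ys = ℕₚ.≤-reflexive (count-empty P? (λ y p → case-[] (P⊆ y p)) ys)
    where
    case-[] : ∀ {R : Pred A 0ℓ} → ¬ Any R []
    case-[] ()
  count-union P? Q? (x ∷ xs) P⊆ ys = ℕₚ.≤-trans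
    (count-⊎ P? (Q? x) (λ y → any? (λ x → Q? x y) xs) (λ y p → split (P⊆ y p)) ys)
    (ℕₚ.+-monoʳ-≤ _ (count-union (λ y → any? (λ x → Q? x y) xs) Q? xs (λ _ → id) ys))
    where
    split : ∀ {R : Pred A 0ℓ} {x xs} → Any R (x ∷ xs) → R x ⊎ Any R xs
    split (here r)  = inj₁ r
    split (there r) = inj₂ r

  count-map : {P : Pred B 0ℓ} (P? : Decidable P) (f : A → B) → ∀ xs → count P? (map f xs) ≡ count (P? ∘ f) xs
  count-map P? f [] = refl
  count-map P? f (x ∷ xs) with does (P? (f x))
  ... | true  = cong suc (count-map P? f xs)
  ... | false = count-map P? f xs

  count-cartesianProductWith : {P : Pred C 0ℓ} (P? : Decidable P) (f : A → B → C) → ∀ xs ys →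
    count P? (cartesianProductWith f xs ys) ≡ ∑ xs (λ x → count (P? ∘ f x) ys)
  count-cartesianProductWith P? f [] ys = refl
  count-cartesianProductWith P? f (x ∷ xs) ys = trans
    (cong length (Listₚ.filter-++ P? (map (f x) ys) (cartesianProductWith f xs ys)))
    (trans (Listₚ.length-++ (filter P? (map (f x) ys)))
      (cong₂ _+_ (count-map P? (f x) ys) (count-cartesianProductWith P? f xs ys)))

  ∑-bound : ∀ K T {f : A → ℕ} xs → (∀ x → x ∈ xs → K * f x ≤ T) → K * ∑ xs f ≤ length xs * T
  ∑-bound K T [] f≤T = ℕₚ.≤-reflexive (ℕₚ.*-zeroʳ K)
  ∑-bound K T {f} (x ∷ xs) f≤T = begin
    K * (f x + ∑ xs f)        ≡⟨ ℕₚ.*-distribˡ-+ K (f x) (∑ xs f) ⟩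
    K * f x + K * ∑ xs f      ≤⟨ ℕₚ.+-mono-≤ (f≤T x (here refl)) (∑-bound K T xs (λ y → f≤T y ∘ there)) ⟩
    T + length xs * T         ∎
    where open ℕₚ.≤-Reasoning

  ∑-support : ∀ K {P : Pred A 0ℓ} (P? : Decidable P) (f : A → ℕ) → (∀ x → P x → f x ≤ K) → (∀ x → ¬ P x → f x ≡ 0) →
    ∀ xs → ∑ xs f ≤ count P? xs * K
  ∑-support K P? f f≤K f≡0 [] = z≤n
  ∑-support K P? f f≤K f≡0 (x ∷ xs) with P? x
  ... | yes p = ℕₚ.+-mono-≤ (f≤K x p) (∑-support K P? f f≤K f≡0 xs)
  ... | no ¬p rewrite f≡0 x ¬p = ∑-support K P? f f≤K f≡0 xs

  length-cartesianProductWith : (f : A → B → C) → ∀ xs ys →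
    length (cartesianProductWith f xs ys) ≡ length xs * length ys
  length-cartesianProductWith f [] ys = refl
  length-cartesianProductWith f (x ∷ xs) ys = trans (Listₚ.length-++ (map (f x) ys))
    (cong₂ _+_ (Listₚ.length-map (f x) ys) (length-cartesianProductWith f xs ys))

  length-vectors : ∀ (xs : List A) n → length (vectors xs n) ≡ length xs ^ n
  length-vectors xs zero    = refl
  length-vectors xs (suc n) = trans (length-cartesianProductWith _∷_ xs (vectors xs n))
    (cong (length xs *_) (length-vectors xs n))

  -- The queries are independent, so the proportions of the single queries multiply.
  count-All-vectors : {P : Pred A 0ℓ} (P? : Decidable P) → ∀ xs m → count (All.all? P?) (vectors xs m) ≤ count P? xs ^ m
  count-All-vectors P? xs zero    = ℕₚ.≤-refl
  count-All-vectors {P = P} P? xs (suc m) = begin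
    count (All.all? P?) (cartesianProductWith _∷_ xs (vectors xs m))
      ≡⟨ count-cartesianProductWith (All.all? P?) _∷_ xs (vectors xs m) ⟩
    ∑ xs (λ x → count (All.all? P? ∘ (x ∷_)) (vectors xs m))
      ≤⟨ ∑-support (count P? xs ^ m) P? _
           (λ x _ → ℕₚ.≤-trans (count-mono _ (All.all? P?) (λ _ → All.tail) (vectors xs m)) (count-All-vectors P? xs m))
           (λ x ¬p → count-empty _ (λ _ ps → ¬p (All.head ps)) (vectors xs m)) xs ⟩
    count P? xs * count P? xs ^ m ∎
    where open ℕₚ.≤-Reasoning

  excess : ∀ {n} → Signal n → Signal n → ℕ
  excess []             []             = 0
  excess (zero ∷ σ)     (_ ∷ τ)        = excess σ τ
  excess (suc zero ∷ σ) (zero ∷ τ)     = suc (excess σ τ)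
  excess (suc zero ∷ σ) (suc zero ∷ τ) = excess σ τ

  agreement : ∀ {n} → Signal n → Signal n → ℕ
  agreement []             []             = 0
  agreement (zero ∷ σ)     (zero ∷ τ)     = suc (agreement σ τ)
  agreement (zero ∷ σ)     (suc zero ∷ τ) = agreement σ τ
  agreement (suc zero ∷ σ) (zero ∷ τ)     = agreement σ τ
  agreement (suc zero ∷ σ) (suc zero ∷ τ) = suc (agreement σ τ)

  distance : ∀ {n} → Signal n → Signal n → ℕ
  distance σ τ = excess σ τ + excess τ σ

  agreement+distance : ∀ {n} (σ τ : Signal n) → agreement σ τ + distance σ τ ≡ n
  agreement+distance []             []             = refl
  agreement+distance (zero ∷ σ)     (zero ∷ τ)     = cong suc (agreement+distance σ τ)
  agreement+distance (zero ∷ σ)     (suc zero ∷ τ) = trans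
    (trans (cong (agreement σ τ +_) (ℕₚ.+-suc _ _)) (ℕₚ.+-suc _ _)) (cong suc (agreement+distance σ τ))
  agreement+distance (suc zero ∷ σ) (zero ∷ τ)     = trans (ℕₚ.+-suc _ _) (cong suc (agreement+distance σ τ))
  agreement+distance (suc zero ∷ σ) (suc zero ∷ τ) = cong suc (agreement+distance σ τ)

  weight+excess : ∀ {n} (σ τ : Signal n) → weight σ + excess τ σ ≡ weight τ + excess σ τ
  weight+excess []             []             = refl
  weight+excess (zero ∷ σ)     (zero ∷ τ)     = weight+excess σ τ
  weight+excess (zero ∷ σ)     (suc zero ∷ τ) = trans (ℕₚ.+-suc _ _) (cong suc (weight+excess σ τ))
  weight+excess (suc zero ∷ σ) (zero ∷ τ)     = trans (cong suc (weight+excess σ τ)) (sym (ℕₚ.+-suc _ _))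
  weight+excess (suc zero ∷ σ) (suc zero ∷ τ) = cong suc (weight+excess σ τ)

  excess-sym : ∀ {n} (σ τ : Signal n) → weight σ ≡ weight τ → excess τ σ ≡ excess σ τ
  excess-sym σ τ σ≡τ = ℕₚ.+-cancelˡ-≡ (weight τ) _ _ (trans (cong (_+ excess τ σ) (sym σ≡τ)) (weight+excess σ τ))

  excess≡0⇒≡ : ∀ {n} (σ τ : Signal n) → excess σ τ ≡ 0 → excess τ σ ≡ 0 → σ ≡ τ
  excess≡0⇒≡ []             []             _ _ = refl
  excess≡0⇒≡ (zero ∷ σ)     (zero ∷ τ)     p q = cong (zero ∷_) (excess≡0⇒≡ σ τ p q)
  excess≡0⇒≡ (zero ∷ σ)     (suc zero ∷ τ) p ()
  excess≡0⇒≡ (suc zero ∷ σ) (zero ∷ τ)     () q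
  excess≡0⇒≡ (suc zero ∷ σ) (suc zero ∷ τ) p q = cong (suc zero ∷_) (excess≡0⇒≡ σ τ p q)

  -- Every point of the ball arises from `r` choices, each of a position to flip or of no flip. In
  -- the induction on the first entry, agreement keeps the radius and a flip lowers it by one.
  count-ball : ∀ {n} (σ : Signal n) r → count (λ τ → distance σ τ ℕₚ.≤? r) (vectors (allFin 2) n) ≤ suc n ^ r
  count-ball [] r = ℕₚ.≤-reflexive (sym (ℕₚ.^-zeroˡ r))
  count-ball {suc n} (b ∷ σ) r = ℕₚ.≤-trans
    (ℕₚ.≤-reflexive (count-cartesianProductWith (λ τ → distance (b ∷ σ) τ ℕₚ.≤? r) _∷_ (allFin 2) (vectors (allFin 2) n)))
    (go b r)
    where
    open ℕₚ.≤-Reasoning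
    V : List (Signal n)
    V = vectors (allFin 2) n
    flip-bound : ∀ r b c → (∀ τ → distance (b ∷ σ) (c ∷ τ) ≡ suc (distance σ τ)) →
      suc n ^ r + count (λ τ → distance (b ∷ σ) (c ∷ τ) ℕₚ.≤? r) V ≤ suc (suc n) ^ r
    flip-bound zero b c eq = ℕₚ.≤-reflexive (cong suc
      (count-empty _ (λ τ d≤0 → contradiction (ℕₚ.≤-trans (ℕₚ.≤-reflexive (sym (eq τ))) d≤0) λ ()) V))
    flip-bound (suc r) b c eq = begin
      suc n ^ suc r + count (λ τ → distance (b ∷ σ) (c ∷ τ) ℕₚ.≤? suc r) V
        ≤⟨ ℕₚ.+-monoʳ-≤ (suc n ^ suc r) (ℕₚ.≤-trans
             (count-mono _ (λ τ → distance σ τ ℕₚ.≤? r) (λ τ d≤ → ℕₚ.≤-pred (ℕₚ.≤-trans (ℕₚ.≤-reflexive (sym (eq τ))) d≤)) V)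
             (count-ball σ r)) ⟩
      suc n ^ suc r + suc n ^ r   ≡⟨ ℕₚ.+-comm (suc n ^ suc r) (suc n ^ r) ⟩
      suc (suc n) * suc n ^ r     ≤⟨ ℕₚ.*-monoʳ-≤ (suc (suc n)) (ℕₚ.^-monoˡ-≤ r (ℕₚ.n≤1+n (suc n))) ⟩
      suc (suc n) ^ suc r         ∎
    go : ∀ b r → count (λ τ → distance (b ∷ σ) (zero ∷ τ) ℕₚ.≤? r) V + (count (λ τ → distance (b ∷ σ) (suc zero ∷ τ) ℕₚ.≤? r) V + 0) ≤ suc (suc n) ^ r
    go zero r = begin
      count (λ τ → distance σ τ ℕₚ.≤? r) V + (count (λ τ → distance (zero ∷ σ) (suc zero ∷ τ) ℕₚ.≤? r) V + 0)
        ≡⟨ cong (count (λ τ → distance σ τ ℕₚ.≤? r) V +_) (ℕₚ.+-identityʳ _) ⟩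
      count (λ τ → distance σ τ ℕₚ.≤? r) V + count (λ τ → distance (zero ∷ σ) (suc zero ∷ τ) ℕₚ.≤? r) V
        ≤⟨ ℕₚ.+-monoˡ-≤ _ (count-ball σ r) ⟩
      suc n ^ r + count (λ τ → distance (zero ∷ σ) (suc zero ∷ τ) ℕₚ.≤? r) V
        ≤⟨ flip-bound r zero (suc zero) (λ τ → ℕₚ.+-suc _ _) ⟩
      suc (suc n) ^ r ∎
    go (suc zero) r = begin
      count (λ τ → distance (suc zero ∷ σ) (zero ∷ τ) ℕₚ.≤? r) V + (count (λ τ → distance σ τ ℕₚ.≤? r) V + 0)
        ≡⟨ cong (count (λ τ → distance (suc zero ∷ σ) (zero ∷ τ) ℕₚ.≤? r) V +_) (ℕₚ.+-identityʳ _) ⟩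
      count (λ τ → distance (suc zero ∷ σ) (zero ∷ τ) ℕₚ.≤? r) V + count (λ τ → distance σ τ ℕₚ.≤? r) V
        ≡⟨ ℕₚ.+-comm _ (count (λ τ → distance σ τ ℕₚ.≤? r) V) ⟩
      count (λ τ → distance σ τ ℕₚ.≤? r) V + count (λ τ → distance (suc zero ∷ σ) (zero ∷ τ) ℕₚ.≤? r) V
        ≤⟨ ℕₚ.+-monoˡ-≤ _ (count-ball σ r) ⟩
      suc n ^ r + count (λ τ → distance (suc zero ∷ σ) (zero ∷ τ) ℕₚ.≤? r) V
        ≤⟨ flip-bound r (suc zero) zero (λ τ → refl) ⟩
      suc (suc n) ^ r ∎

  binomial-≤ : ∀ n j → n ^ suc j + suc j * n ^ j ≤ suc n ^ suc j
  binomial-≤ n zero    = ℕₚ.≤-reflexive (ring n)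
    where
    ring : ∀ n → n * 1 + 1 * 1 ≡ (1 + n) * 1
    ring = solve-∀
  binomial-≤ n (suc j) = begin
    n * n ^ suc j + suc (suc j) * n ^ suc j            ≤⟨ ℕₚ.m≤m+n _ (suc j * n ^ j) ⟩
    n * n ^ suc j + suc (suc j) * n ^ suc j + suc j * n ^ j ≡⟨ ring n j (n ^ j) ⟩
    suc n * (n ^ suc j + suc j * n ^ j)                ≤⟨ ℕₚ.*-monoʳ-≤ (suc n) (binomial-≤ n j) ⟩
    suc n * suc n ^ suc j                              ∎
    where
    open ℕₚ.≤-Reasoning
    ring : ∀ n j x → n * (n * x) + (2 + j) * (n * x) + (1 + j) * x ≡ (1 + n) * (n * x + (1 + j) * x)
    ring = solve-∀

  -- Pascal's rule for the first entry; multiplied by the factorial, its induction step is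
  -- `binomial-≤`. Together with `k^k≤4^k*k!` this gives the estimate (4 n/k)^k.
  length-signals : ∀ n k → length (signals n k) * k ! ≤ n ^ k
  length-signals zero    zero    = ℕₚ.≤-refl
  length-signals zero    (suc k) = z≤n
  length-signals (suc n) k = ℕₚ.≤-trans
    (ℕₚ.≤-reflexive (cong (_* k !) (count-cartesianProductWith (λ σ → weight σ ℕ.≟ k) _∷_ (allFin 2) (vectors (allFin 2) n))))
    (go k)
    where
    open ℕₚ.≤-Reasoning
    V : List (Signal n)
    V = vectors (allFin 2) n
    ring : ∀ x y k f → (x + (y + 0)) * ((1 + k) * f) ≡ x * ((1 + k) * f) + (1 + k) * (y * f)
    ring = solve-∀
    go : ∀ k → (length (signals n k) + (count (λ σ → suc (weight σ) ℕ.≟ k) V + 0)) * k ! ≤ suc n ^ k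
    go zero = begin
      (length (signals n 0) + (count (λ σ → suc (weight σ) ℕ.≟ 0) V + 0)) * 1
        ≡⟨ cong (λ x → (length (signals n 0) + (x + 0)) * 1) (count-empty (λ σ → suc (weight σ) ℕ.≟ 0) (λ _ ()) V) ⟩
      (length (signals n 0) + 0) * 1
        ≡⟨ cong (_* 1) (ℕₚ.+-identityʳ (length (signals n 0))) ⟩
      length (signals n 0) * 1
        ≤⟨ length-signals n 0 ⟩
      1 ∎
    go (suc k) = begin
      (length (signals n (suc k)) + (count (λ σ → suc (weight σ) ℕ.≟ suc k) V + 0)) * suc k !
        ≡⟨ cong (λ x → (length (signals n (suc k)) + (x + 0)) * suc k !)
             (count-cong (λ σ → suc (weight σ) ℕ.≟ suc k) (λ σ → weight σ ℕ.≟ k) (λ _ → ℕₚ.suc-injective) (λ _ → cong suc) V) ⟩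
      (length (signals n (suc k)) + (length (signals n k) + 0)) * suc k !
        ≡⟨ ring (length (signals n (suc k))) (length (signals n k)) k (k !) ⟩
      length (signals n (suc k)) * suc k ! + suc k * (length (signals n k) * k !)
        ≤⟨ ℕₚ.+-mono-≤ (length-signals n (suc k)) (ℕₚ.*-monoʳ-≤ (suc k) (length-signals n k)) ⟩
      n ^ suc k + suc k * n ^ k
        ≤⟨ binomial-≤ n k ⟩
      suc n ^ suc k ∎

  change : ∀ {n} → Signal n → Signal n → Fin n → ℤ
  change σ τ i = Fin.toℕ (lookup σ i) ℤ.⊖ Fin.toℕ (lookup τ i)

  drift : ∀ {n Γ} → Signal n → Signal n → Vec (Fin n) Γ → ℤ
  drift σ τ []      = 0ℤ
  drift σ τ (i ∷ v) = change σ τ i ℤ.+ drift σ τ v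

  -- One draw is a step 0, 1 or -1 with frequencies `agreement σ τ`, `excess σ τ` and `excess τ σ`.
  -- The tabulated `g` is arbitrary because the recursion on the signals passes to `g ∘ suc`;
  -- `allFin` is the case `id`.
  ∑-tabulate : ∀ {n} {A : Set} (σ τ : Signal n) (g : Fin n → A) (f : A → ℕ) (h : ℤ → ℤ) →
    (∀ i → ℤ.+ f (g i) ≡ h (change σ τ i)) →
    ℤ.+ ∑ (List.tabulate g) f ≡
      ℤ.+ agreement σ τ ℤ.* h 0ℤ ℤ.+ (ℤ.+ excess σ τ ℤ.* h 1ℤ ℤ.+ ℤ.+ excess τ σ ℤ.* h -1ℤ)
  ∑-tabulate []                []             g f h eq = refl
  ∑-tabulate (b ∷ σ) (c ∷ τ) g f h eq =
    trans (cong₂ ℤ._+_ (eq zero) (∑-tabulate σ τ (g ∘ suc) f h (eq ∘ suc))) (go b c)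
    where
    x y z : ℤ
    x = ℤ.+ agreement σ τ
    y = ℤ.+ excess σ τ
    z = ℤ.+ excess τ σ
    ring-agree : ∀ x y z a b c → a ℤ.+ (x ℤ.* a ℤ.+ (y ℤ.* b ℤ.+ z ℤ.* c)) ≡ (1ℤ ℤ.+ x) ℤ.* a ℤ.+ (y ℤ.* b ℤ.+ z ℤ.* c)
    ring-agree = ℤ-Solver.solve-∀
    ring-up : ∀ x y z a b c → b ℤ.+ (x ℤ.* a ℤ.+ (y ℤ.* b ℤ.+ z ℤ.* c)) ≡ x ℤ.* a ℤ.+ ((1ℤ ℤ.+ y) ℤ.* b ℤ.+ z ℤ.* c)
    ring-up = ℤ-Solver.solve-∀
    ring-down : ∀ x y z a b c → c ℤ.+ (x ℤ.* a ℤ.+ (y ℤ.* b ℤ.+ z ℤ.* c)) ≡ x ℤ.* a ℤ.+ (y ℤ.* b ℤ.+ (1ℤ ℤ.+ z) ℤ.* c)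
    ring-down = ℤ-Solver.solve-∀
    go : ∀ b c → h (Fin.toℕ b ℤ.⊖ Fin.toℕ c) ℤ.+ (x ℤ.* h 0ℤ ℤ.+ (y ℤ.* h 1ℤ ℤ.+ z ℤ.* h -1ℤ))
      ≡ ℤ.+ agreement (b ∷ σ) (c ∷ τ) ℤ.* h 0ℤ ℤ.+ (ℤ.+ excess (b ∷ σ) (c ∷ τ) ℤ.* h 1ℤ ℤ.+ ℤ.+ excess (c ∷ τ) (b ∷ σ) ℤ.* h -1ℤ)
    go zero       zero       = ring-agree x y z (h 0ℤ) (h 1ℤ) (h -1ℤ)
    go zero       (suc zero) = ring-down x y z (h 0ℤ) (h 1ℤ) (h -1ℤ)
    go (suc zero) zero       = ring-up x y z (h 0ℤ) (h 1ℤ) (h -1ℤ)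
    go (suc zero) (suc zero) = ring-agree x y z (h 0ℤ) (h 1ℤ) (h -1ℤ)

  isZero-≢ : ∀ s → s ≢ 0ℤ → isZero s ≡ 0ℤ
  isZero-≢ (ℤ.+ zero)    s≢0 = contradiction refl s≢0
  isZero-≢ (ℤ.+ suc _)   _   = refl
  isZero-≢ (ℤ.-[1+ _ ]) _   = refl

  module _ {n} (σ τ : Signal n) (balanced : excess τ σ ≡ excess σ τ) where
    open LazyWalk (agreement σ τ) (excess σ τ)

    -- Conditioning on the first draw moves the starting point, hence the general `z`. By
    -- `balanced`, the frequencies of up and down steps merge into the single parameter d of
    -- `LazyWalk`.
    count-drift : ∀ Γ z → ℤ.+ count (λ v → z ℤ.+ drift σ τ v ℤ.≟ 0ℤ) (vectors (allFin n) Γ) ≡ E Γ (λ s → isZero (z ℤ.+ s))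
    count-drift zero z with z ℤ.+ 0ℤ ℤ.≟ 0ℤ
    ... | yes z≡0 = sym (cong isZero z≡0)
    ... | no  z≢0 = sym (isZero-≢ _ z≢0)
    count-drift (suc Γ) z = begin
      ℤ.+ count (λ v → z ℤ.+ drift σ τ v ℤ.≟ 0ℤ) (vectors (allFin n) (suc Γ))
        ≡⟨ cong ℤ.+_ (count-cartesianProductWith (λ v → z ℤ.+ drift σ τ v ℤ.≟ 0ℤ) _∷_ (allFin n) (vectors (allFin n) Γ)) ⟩
      ℤ.+ ∑ (allFin n) (λ i → count (λ v → z ℤ.+ (change σ τ i ℤ.+ drift σ τ v) ℤ.≟ 0ℤ) (vectors (allFin n) Γ))
        ≡⟨ ∑-tabulate σ τ id _ h (λ i → trans (cong ℤ.+_ (shift (change σ τ i))) (count-drift Γ (z ℤ.+ change σ τ i))) ⟩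
      ℤ.+ agreement σ τ ℤ.* h 0ℤ ℤ.+ (ℤ.+ excess σ τ ℤ.* h 1ℤ ℤ.+ ℤ.+ excess τ σ ℤ.* h -1ℤ)
        ≡⟨ cong (λ d → ℤ.+ agreement σ τ ℤ.* h 0ℤ ℤ.+ (ℤ.+ excess σ τ ℤ.* h 1ℤ ℤ.+ ℤ.+ d ℤ.* h -1ℤ)) balanced ⟩
      ℤ.+ agreement σ τ ℤ.* h 0ℤ ℤ.+ (ℤ.+ excess σ τ ℤ.* h 1ℤ ℤ.+ ℤ.+ excess σ τ ℤ.* h -1ℤ)
        ≡⟨ cong₂ ℤ._+_ (cong (ℤ.+ agreement σ τ ℤ.*_) (E-cong Γ λ s → cong (λ x → isZero (x ℤ.+ s)) (ℤₚ.+-identityʳ z)))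
             (trans (sym (ℤₚ.*-distribˡ-+ (ℤ.+ excess σ τ) (h 1ℤ) (h -1ℤ)))
               (cong (ℤ.+ excess σ τ ℤ.*_) (cong₂ ℤ._+_
                 (E-cong Γ λ s → cong isZero (ℤₚ.+-assoc z 1ℤ s))
                 (E-cong Γ λ s → cong isZero (ℤₚ.+-assoc z -1ℤ s))))) ⟩
      E (suc Γ) (λ s → isZero (z ℤ.+ s)) ∎
      where
      open ≡-Reasoning
      h : ℤ → ℤ
      h e = E Γ (λ s → isZero ((z ℤ.+ e) ℤ.+ s))
      shift : ∀ e → count (λ v → z ℤ.+ (e ℤ.+ drift σ τ v) ℤ.≟ 0ℤ) (vectors (allFin n) Γ)
                  ≡ count (λ v → (z ℤ.+ e) ℤ.+ drift σ τ v ℤ.≟ 0ℤ) (vectors (allFin n) Γ)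
      shift e = count-cong _ _ (λ v → trans (ℤₚ.+-assoc z e (drift σ τ v)))
                               (λ v → trans (sym (ℤₚ.+-assoc z e (drift σ τ v)))) (vectors (allFin n) Γ)

  driftless : ∀ {n} → Signal n → Signal n → ∀ Γ → ℕ
  driftless {n} σ τ Γ = count (λ v → drift σ τ v ℤ.≟ 0ℤ) (vectors (allFin n) Γ)

  module _ {n Γ} .{{_ : NonZero n}} (n≤2Γ+2 : n ≤ 2 * suc Γ) (σ τ : Signal n) (σ∼τ : weight σ ≡ weight τ) where
    open LazyWalk (agreement σ τ) (excess σ τ)

    private
      balanced : excess τ σ ≡ excess σ τ
      balanced = excess-sym σ τ σ∼τ

      steps≡n : steps ≡ n
      steps≡n = trans (cong (λ e → agreement σ τ + (excess σ τ + e)) (sym balanced)) (agreement+distance σ τ)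

      instance
        steps≢0 : NonZero steps
        steps≢0 = subst NonZero (sym steps≡n) (ℕ.≢-nonZero (ℕ.≢-nonZero⁻¹ n))

      driftless≡ : ℤ.+ driftless σ τ Γ ≡ E Γ isZero
      driftless≡ = trans
        (cong ℤ.+_ (count-cong _ _ (λ v → trans (ℤₚ.+-identityˡ _)) (λ v → trans (sym (ℤₚ.+-identityˡ _))) (vectors (allFin n) Γ)))
        (trans (count-drift σ τ balanced Γ 0ℤ) (E-cong Γ λ s → cong isZero (ℤₚ.+-identityˡ s)))

      range : steps ≤ 2 * suc Γ
      range = subst (_≤ 2 * suc Γ) (sym steps≡n) n≤2Γ+2

    driftless-bound : excess σ τ * (driftless σ τ Γ * driftless σ τ Γ) ≤ n ^ Γ * n ^ Γ
    driftless-bound = subst (λ x → excess σ τ * (driftless σ τ Γ * driftless σ τ Γ) ≤ x ^ Γ * x ^ Γ) steps≡n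
      (return-bound (agreement σ τ) (excess σ τ) driftless≡ range)

    driftless-bound-constant : σ ≢ τ → 5 ≤ n → 4 * driftless σ τ Γ ≤ 3 * n ^ Γ
    driftless-bound-constant σ≢τ n≥5 = subst (λ x → 4 * driftless σ τ Γ ≤ 3 * x ^ Γ) steps≡n
      (return-bound-constant (agreement σ τ) (excess σ τ) driftless≡ range
        (ℕₚ.n≢0⇒n>0 λ e≡0 → σ≢τ (excess≡0⇒≡ σ τ e≡0 (trans balanced e≡0)))
        (subst (5 ≤_) (sym steps≡n) n≥5))

-- The decoder and the union bound for its failures.

module Decoding where
  open Counting
  open import Data.Nat using (_+_; _*_; _^_; _≤_; _<_)
  open import Data.Nat.Tactic.RingSolver using (solve-∀)

  dot : ∀ {n} → (Fin n → ℕ) → Vec ℕ n → ℕ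
  dot f xs = Vec.sum (Vec.zipWith _*_ (Vec.tabulate f) xs)

  indicator : ∀ {n} → Fin n → Fin n → ℕ
  indicator i j = if does (i Fin.≟ j) then 1 else 0

  dot-zero : ∀ {n} (xs : Vec ℕ n) → dot (λ _ → 0) xs ≡ 0
  dot-zero []       = refl
  dot-zero (x ∷ xs) = dot-zero xs

  dot-indicator : ∀ {n} (j : Fin n) xs → dot (λ i → indicator i j) xs ≡ lookup xs j
  dot-indicator zero    (x ∷ xs) = trans (cong₂ _+_ (ℕₚ.*-identityˡ x) (dot-zero xs)) (ℕₚ.+-identityʳ x)
  dot-indicator (suc j) (x ∷ xs) = dot-indicator j xs

  dot-+ : ∀ {n} (f g h : Fin n → ℕ) → (∀ i → h i ≡ f i + g i) → ∀ xs → dot h xs ≡ dot f xs + dot g xs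
  dot-+ f g h h≗ []       = refl
  dot-+ f g h h≗ (x ∷ xs) = trans
    (cong₂ (λ a b → a * x + b) (h≗ zero) (dot-+ (f ∘ suc) (g ∘ suc) (h ∘ suc) (h≗ ∘ suc) xs))
    (ring (f zero) (g zero) x (dot (f ∘ suc) xs) (dot (g ∘ suc) xs))
    where
    ring : ∀ a b x c d → (a + b) * x + (c + d) ≡ (a * x + c) + (b * x + d)
    ring = solve-∀

  pooled : ∀ {n Γ} → Signal n → Vec (Fin n) Γ → ℕ
  pooled σ []      = 0
  pooled σ (i ∷ v) = Fin.toℕ (lookup σ i) + pooled σ v

  -- Double counting: multiplicities are sums of indicators over the draws, and each indicator
  -- selects one entry of `σ`. Thus a result computed from the multigraph becomes a sum along the
  -- draws, the form in which the walk appears.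
  dot-count : ∀ {n Γ} (σ : Signal n) (v : Vec (Fin n) Γ) →
    dot (λ i → Vec.count (i Fin.≟_) v) (Vec.map Fin.toℕ σ) ≡ pooled σ v
  dot-count σ []      = dot-zero (Vec.map Fin.toℕ σ)
  dot-count σ (j ∷ v) = trans
    (dot-+ (λ i → indicator i j) (λ i → Vec.count (i Fin.≟_) v) _ unfold (Vec.map Fin.toℕ σ))
    (cong₂ _+_ (trans (dot-indicator j (Vec.map Fin.toℕ σ)) (Vecₚ.lookup-map j Fin.toℕ σ)) (dot-count σ v))
    where
    unfold : ∀ i → Vec.count (i Fin.≟_) (j ∷ v) ≡ indicator i j + Vec.count (i Fin.≟_) v
    unfold i with does (i Fin.≟ j)
    ... | true  = refl
    ... | false = refl

  drift-pooled : ∀ {n Γ} (σ τ : Signal n) (v : Vec (Fin n) Γ) → drift σ τ v ≡ pooled σ v ℤ.⊖ pooled τ v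
  drift-pooled σ τ []      = refl
  drift-pooled σ τ (i ∷ v) = begin
    (a ℤ.⊖ b) ℤ.+ drift σ τ v                      ≡⟨ cong (λ x → (a ℤ.⊖ b) ℤ.+ x) (drift-pooled σ τ v) ⟩
    (a ℤ.⊖ b) ℤ.+ (c ℤ.⊖ d)                        ≡⟨ cong₂ ℤ._+_ (ℤₚ.m-n≡m⊖n a b) (ℤₚ.m-n≡m⊖n c d) ⟨
    (ℤ.+ a ℤ.- ℤ.+ b) ℤ.+ (ℤ.+ c ℤ.- ℤ.+ d)        ≡⟨ ring (ℤ.+ a) (ℤ.+ b) (ℤ.+ c) (ℤ.+ d) ⟩
    (ℤ.+ a ℤ.+ ℤ.+ c) ℤ.- (ℤ.+ b ℤ.+ ℤ.+ d)        ≡⟨ ℤₚ.m-n≡m⊖n (a + c) (b + d) ⟩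
    (a + c) ℤ.⊖ (b + d)                            ∎
    where
    open ≡-Reasoning
    a b c d : ℕ
    a = Fin.toℕ (lookup σ i)
    b = Fin.toℕ (lookup τ i)
    c = pooled σ v
    d = pooled τ v
    ring : ∀ a b c d → (a ℤ.- b) ℤ.+ (c ℤ.- d) ≡ (a ℤ.+ c) ℤ.- (b ℤ.+ d)
    ring = ℤ-Solver.solve-∀

  confused? : ∀ {n m Γ} (σ τ : Signal n) → Decidable {A = Draws n m Γ} (All (λ v → drift σ τ v ≡ 0ℤ))
  confused? σ τ = All.all? (λ v → drift σ τ v ℤ.≟ 0ℤ)

  results-≡⇒driftless : ∀ {n m Γ} (σ τ : Signal n) (ω : Draws n m Γ) →
    results (multigraph ω) τ ≡ results (multigraph ω) σ → All (λ v → drift σ τ v ≡ 0ℤ) ω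
  results-≡⇒driftless σ τ []      _  = []
  results-≡⇒driftless σ τ (v ∷ ω) eq =
    trans (drift-pooled σ τ v) (trans (cong (pooled σ v ℤ.⊖_) same) (ℤₚ.n⊖n≡0 (pooled σ v)))
    ∷ results-≡⇒driftless σ τ ω (Vecₚ.∷-injectiveʳ eq)
    where
    same : pooled τ v ≡ pooled σ v
    same = trans (sym (dot-count τ v)) (trans (Vecₚ.∷-injectiveˡ eq) (dot-count σ v))

  headOr : {A : Set} → A → List A → A
  headOr x []      = x
  headOr _ (y ∷ _) = y

  headOr-∈ : {A : Set} (x : A) {y : A} {ys : List A} → y ∈ ys → headOr x ys ∈ ys
  headOr-∈ x {ys = _ ∷ _} _ = here refl

  consistent? : ∀ {n m} (G : Multigraph n m) (y : Vec ℕ m) → Decidable (λ σ → results G σ ≡ y)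
  consistent? G y σ = Vecₚ.≡-dec ℕ._≟_ (results G σ) y

  -- The zero signal is the value at pairs of a graph and results that no signal of weight `k`
  -- explains.
  decoder : ∀ n k m → Decoder n m
  decoder n k m G y = headOr (Vec.replicate n zero) (filter (consistent? G y) (signals n k))

  nonempty : ∀ {A : Set} {x : A} {xs} → x ∈ xs → NonZero (length xs)
  nonempty (here _)  = _
  nonempty (there _) = _

  ∈-vectors : ∀ {A : Set} {xs : List A} → (∀ x → x ∈ xs) → ∀ {n} (v : Vec A n) → v ∈ vectors xs n
  ∈-vectors all∈ []      = here refl
  ∈-vectors all∈ (x ∷ v) = ∈-cartesianProductWith⁺ _∷_ (all∈ x) (∈-vectors all∈ v)

  length-draws : ∀ n m Γ → length (draws n m Γ) ≡ (n ^ Γ) ^ m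
  length-draws n m Γ = trans (length-vectors (vectors (allFin n) Γ) m) (cong (_^ m)
    (trans (length-vectors (allFin n) Γ) (cong (_^ Γ) (Listₚ.length-tabulate id))))

  *-cancel-square-≤ : ∀ {x y} → x * x ≤ y * y → x ≤ y
  *-cancel-square-≤ {x} {y} x²≤y² with x ℕₚ.≤? y
  ... | yes x≤y = x≤y
  ... | no  x≰y = contradiction (ℕₚ.*-mono-< (ℕₚ.≰⇒> x≰y) (ℕₚ.≰⇒> x≰y)) (ℕₚ.≤⇒≯ x²≤y²)

  ^-distribʳ-* : ∀ m x y → (x * y) ^ m ≡ x ^ m * y ^ m
  ^-distribʳ-* zero    x y = refl
  ^-distribʳ-* (suc m) x y = trans (cong (x * y *_) (^-distribʳ-* m x y)) (ring x y (x ^ m) (y ^ m))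
    where
    ring : ∀ x y a b → x * y * (a * b) ≡ x * a * (y * b)
    ring = solve-∀

  -- The union bound without division: among `T` outcomes, at most `L` events of proportion at most
  -- 1/(L K) have total proportion at most 1/K.
  ∑-cancel : ∀ {A : Set} L K T .{{_ : NonZero L}} {f : A → ℕ} xs → length xs ≤ L →
    (∀ x → x ∈ xs → L * K * f x ≤ T) → K * ∑ xs f ≤ T
  ∑-cancel L K T {f} xs ≤L f≤T = ℕₚ.*-cancelˡ-≤ L (begin
    L * (K * ∑ xs f)   ≡⟨ ℕₚ.*-assoc L K (∑ xs f) ⟨
    L * K * ∑ xs f     ≤⟨ ∑-bound (L * K) T xs f≤T ⟩
    length xs * T      ≤⟨ ℕₚ.*-monoˡ-≤ T ≤L ⟩
    L * T              ∎)
    where open ℕₚ.≤-Reasoning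

  failure? : ∀ n k m Γ → Decidable {A = Signal n × Draws n m Γ}
    (λ (σ , ω) → ¬ (decoder n k m (multigraph ω) (results (multigraph ω) σ) ≡ σ))
  failure? n k m Γ (σ , ω) = ¬? (Vecₚ.≡-dec Fin._≟_ (decoder n k m (multigraph ω) (results (multigraph ω) σ)) σ)

  -- The aim is a failure proportion of at most 1/H, with 1/(2 H) granted to each class of
  -- competitors. The far union bound is assumed in squared form, because d₀^(m/2) need not be a
  -- natural number.
  module _ {n k m Γ H d₀ : ℕ} (n≥5 : 5 ≤ n) (n≤2Γ+2 : n ≤ 2 * suc Γ)
           (near-bound : suc n ^ (d₀ + d₀) * (2 * H) * 3 ^ m ≤ 4 ^ m)
           (far-bound : length (signals n k) * (2 * H) * (length (signals n k) * (2 * H)) ≤ d₀ ^ m) where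

    private
      instance
        n≢0 : NonZero n
        n≢0 = ℕ.>-nonZero (ℕₚ.≤-trans (s≤s z≤n) n≥5)

      T : ℕ
      T = (n ^ Γ) ^ m

    module _ (σ : Signal n) (σ∈ : σ ∈ signals n k) where
      private
        open ℕₚ.≤-Reasoning

        near far : List (Signal n)
        Near Far : Pred (Signal n) 0ℓ
        -- At equal weights the distance is twice the excess, so this is the cut d ≤ d₀ expressed by
        -- the Hamming distance, to which `count-ball` applies.
        Near τ = (weight τ ≡ k × τ ≢ σ) × distance σ τ ≤ d₀ + d₀
        Far  τ = τ ≢ σ × d₀ + d₀ < distance σ τ

        near? : Decidable Near
        near? τ = ((weight τ ℕ.≟ k) ×-dec ¬? (Vecₚ.≡-dec Fin._≟_ τ σ)) ×-dec (distance σ τ ℕₚ.≤? d₀ + d₀)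
        far? : Decidable Far
        far? τ = ¬? (Vecₚ.≡-dec Fin._≟_ τ σ) ×-dec (d₀ + d₀ ℕₚ.<? distance σ τ)

        near = filter near? (vectors (allFin 2) n)
        far  = filter far? (signals n k)

        length-near : length near ≤ suc n ^ (d₀ + d₀)
        length-near = ℕₚ.≤-trans
          (count-mono near? (λ τ → distance σ τ ℕₚ.≤? d₀ + d₀) (λ _ → proj₂) (vectors (allFin 2) n))
          (count-ball σ (d₀ + d₀))

        weight-σ : weight σ ≡ k
        weight-σ = proj₂ (∈-filter⁻ (λ σ → weight σ ℕ.≟ k) {xs = vectors (allFin 2) n} σ∈)

        confusions : Signal n → ℕ
        confusions τ = count (confused? σ τ) (draws n m Γ)

        confusions-≤ : ∀ τ → confusions τ ≤ driftless σ τ Γ ^ m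
        confusions-≤ τ = count-All-vectors (λ v → drift σ τ v ℤ.≟ 0ℤ) (vectors (allFin n) Γ) m

        near-confusions : ∀ τ → τ ∈ near → suc n ^ (d₀ + d₀) * (2 * H) * confusions τ ≤ T
        near-confusions τ τ∈ with ∈-filter⁻ near? {xs = vectors (allFin 2) n} τ∈
        ... | _ , (weight-τ , τ≢σ) , _ = ℕₚ.*-cancelˡ-≤ (4 ^ m) {{ℕₚ.m^n≢0 4 m}} (begin
          4 ^ m * (B * confusions τ)      ≤⟨ ℕₚ.*-monoʳ-≤ (4 ^ m) (ℕₚ.*-monoʳ-≤ B (confusions-≤ τ)) ⟩
          4 ^ m * (B * w ^ m)             ≡⟨ ring (4 ^ m) B (w ^ m) ⟩
          B * (4 ^ m * w ^ m)             ≡⟨ cong (B *_) (^-distribʳ-* m 4 w) ⟨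
          B * (4 * w) ^ m                 ≤⟨ ℕₚ.*-monoʳ-≤ B (ℕₚ.^-monoˡ-≤ m
               (driftless-bound-constant n≤2Γ+2 σ τ (trans weight-σ (sym weight-τ)) (τ≢σ ∘ sym) n≥5)) ⟩
          B * (3 * n ^ Γ) ^ m             ≡⟨ cong (B *_) (^-distribʳ-* m 3 (n ^ Γ)) ⟩
          B * (3 ^ m * T)                 ≡⟨ ℕₚ.*-assoc B (3 ^ m) T ⟨
          B * 3 ^ m * T                   ≤⟨ ℕₚ.*-monoˡ-≤ T near-bound ⟩
          4 ^ m * T                       ∎)
          where
          B w : ℕ
          B = suc n ^ (d₀ + d₀) * (2 * H)
          w = driftless σ τ Γ
          ring : ∀ a b c → a * (b * c) ≡ b * (a * c)
          ring = solve-∀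

        far-confusions : ∀ τ → τ ∈ far → length (signals n k) * (2 * H) * confusions τ ≤ T
        far-confusions τ τ∈ with ∈-filter⁻ far? {xs = signals n k} τ∈
        ... | τ∈signals , τ≢σ , distant = *-cancel-square-≤ (begin
          B * confusions τ * (B * confusions τ)
            ≤⟨ ℕₚ.*-mono-≤ (ℕₚ.*-monoʳ-≤ B (confusions-≤ τ)) (ℕₚ.*-monoʳ-≤ B (confusions-≤ τ)) ⟩
          B * w ^ m * (B * w ^ m)
            ≡⟨ ring B (w ^ m) ⟩
          B * B * (w ^ m * w ^ m)
            ≤⟨ ℕₚ.*-monoˡ-≤ (w ^ m * w ^ m) far-bound ⟩
          d₀ ^ m * (w ^ m * w ^ m)
            ≡⟨ cong (d₀ ^ m *_) (^-distribʳ-* m w w) ⟨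
          d₀ ^ m * (w * w) ^ m
            ≡⟨ ^-distribʳ-* m d₀ (w * w) ⟨
          (d₀ * (w * w)) ^ m
            ≤⟨ ℕₚ.^-monoˡ-≤ m (ℕₚ.≤-trans (ℕₚ.*-monoˡ-≤ (w * w) d₀≤) (driftless-bound n≤2Γ+2 σ τ same-weight)) ⟩
          (n ^ Γ * n ^ Γ) ^ m
            ≡⟨ ^-distribʳ-* m (n ^ Γ) (n ^ Γ) ⟩
          T * T ∎)
          where
          B w : ℕ
          B = length (signals n k) * (2 * H)
          w = driftless σ τ Γ
          ring : ∀ a b → a * b * (a * b) ≡ a * a * (b * b)
          ring = solve-∀
          same-weight : weight σ ≡ weight τ
          same-weight = trans weight-σ (sym (proj₂ (∈-filter⁻ (λ τ → weight τ ℕ.≟ k) {xs = vectors (allFin 2) n} τ∈signals)))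
          d₀≤ : d₀ ≤ excess σ τ
          d₀≤ = ℕₚ.≮⇒≥ λ e<d₀ → ℕₚ.<⇒≱ distant
            (ℕₚ.+-mono-≤ (ℕₚ.<⇒≤ e<d₀) (ℕₚ.≤-trans (ℕₚ.≤-reflexive (excess-sym σ τ same-weight)) (ℕₚ.<⇒≤ e<d₀)))

        ConfusedWith : Signal n → Pred (Draws n m Γ) 0ℓ
        ConfusedWith τ = All (λ v → drift σ τ v ≡ 0ℤ)

        somewhere : (xs : List (Signal n)) → Decidable (λ ω → Any (λ τ → ConfusedWith τ ω) xs)
        somewhere xs ω = any? (λ τ → confused? σ τ ω) xs

        failure⇒confused : ∀ ω → ¬ (decoder n k m (multigraph ω) (results (multigraph ω) σ) ≡ σ) →
          Any (λ τ → ConfusedWith τ ω) near ⊎ Any (λ τ → ConfusedWith τ ω) far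
        -- Since `σ` is consistent with its own results, the list searched by the decoder is
        -- nonempty and the output is one of its members, never the default.
        failure⇒confused ω τ≢σ with ∈-filter⁻ (consistent? (multigraph ω) (results (multigraph ω) σ)) {xs = signals n k}
          (headOr-∈ (Vec.replicate n zero) (∈-filter⁺ (consistent? (multigraph ω) (results (multigraph ω) σ)) σ∈ refl))
        ... | τ∈signals , eq with distance σ τ ℕₚ.≤? d₀ + d₀
          where
          τ : Signal n
          τ = decoder n k m (multigraph ω) (results (multigraph ω) σ)
        ...   | yes close = inj₁ (lose (∈-filter⁺ near? τ∈ ((weight-τ , τ≢σ) , close)) (results-≡⇒driftless σ _ ω eq))
          where
          split = ∈-filter⁻ (λ τ → weight τ ℕ.≟ k) {xs = vectors (allFin 2) n} τ∈signals
          τ∈ = proj₁ split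
          weight-τ = proj₂ split
        ...   | no ¬close = inj₂ (lose (∈-filter⁺ far? τ∈signals (τ≢σ , ℕₚ.≰⇒> ¬close)) (results-≡⇒driftless σ _ ω eq))

      failures-at : H * count (λ ω → failure? n k m Γ (σ , ω)) (draws n m Γ) ≤ T
      failures-at = ℕₚ.*-cancelˡ-≤ 2 (begin
        2 * (H * count fail? (draws n m Γ))
          ≡⟨ ℕₚ.*-assoc 2 H _ ⟨
        2 * H * count fail? (draws n m Γ)
          ≤⟨ ℕₚ.*-monoʳ-≤ (2 * H) (ℕₚ.≤-trans
               (count-⊎ fail? (somewhere near) (somewhere far) failure⇒confused (draws n m Γ))
               (ℕₚ.+-mono-≤ (count-union (somewhere near) (confused? σ) near (λ _ → id) (draws n m Γ))
                            (count-union (somewhere far) (confused? σ) far (λ _ → id) (draws n m Γ)))) ⟩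
        2 * H * (∑ near confusions + ∑ far confusions)
          ≡⟨ ℕₚ.*-distribˡ-+ (2 * H) (∑ near confusions) (∑ far confusions) ⟩
        2 * H * ∑ near confusions + 2 * H * ∑ far confusions
          ≤⟨ ℕₚ.+-mono-≤
               (∑-cancel (suc n ^ (d₀ + d₀)) (2 * H) T {{ℕₚ.m^n≢0 (suc n) (d₀ + d₀)}} near length-near near-confusions)
               (∑-cancel (length (signals n k)) (2 * H) T {{nonempty σ∈}} far (Listₚ.length-filter far? (signals n k)) far-confusions) ⟩
        T + T
          ≡⟨ cong (T +_) (ℕₚ.+-identityʳ T) ⟨
        2 * T ∎)
        where
        fail? : Decidable (λ ω → ¬ (decoder n k m (multigraph ω) (results (multigraph ω) σ) ≡ σ))
        fail? ω = failure? n k m Γ (σ , ω)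

    failures : H * count (failure? n k m Γ) (cartesianProduct (signals n k) (draws n m Γ))
      ≤ length (cartesianProduct (signals n k) (draws n m Γ))
    failures = begin
      H * count (failure? n k m Γ) (cartesianProduct (signals n k) (draws n m Γ))
        ≡⟨ cong (H *_) (count-cartesianProductWith (failure? n k m Γ) _,_ (signals n k) (draws n m Γ)) ⟩
      H * ∑ (signals n k) (λ σ → count (λ ω → failure? n k m Γ (σ , ω)) (draws n m Γ))
        ≤⟨ ∑-bound H T (signals n k) failures-at ⟩
      length (signals n k) * T
        ≡⟨ cong (length (signals n k) *_) (length-draws n m Γ) ⟨
      length (signals n k) * length (draws n m Γ)
        ≡⟨ length-cartesianProductWith _,_ (signals n k) (draws n m Γ) ⟨
      length (cartesianProduct (signals n k) (draws n m Γ)) ∎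
      where open ℕₚ.≤-Reasoning

-- The two union bounds for large n, in natural numbers.

module Asymptotics where
  open Decoding using (^-distribʳ-*)
  open import Data.Nat using (_+_; _*_; _^_; _≤_; _<_)
  open import Data.Nat.Tactic.RingSolver using (solve-∀)

  open ℕₚ.≤-Reasoning

  ^-cancelˡ-≤ : ∀ e .{{_ : NonZero e}} {x y} → x ^ e ≤ y ^ e → x ≤ y
  ^-cancelˡ-≤ e {x} {y} xᵉ≤yᵉ with x ℕₚ.≤? y
  ... | yes x≤y = x≤y
  ... | no  x≰y = contradiction (ℕₚ.^-monoˡ-< e (ℕₚ.≰⇒> x≰y)) (ℕₚ.≤⇒≯ xᵉ≤yᵉ)

  m≤m^n : ∀ m n .{{_ : NonZero n}} → m ≤ m ^ n
  m≤m^n zero    n       = z≤n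
  m≤m^n (suc m) (suc n) = ℕₚ.m≤m*n (suc m) (suc m ^ n) {{ℕₚ.m^n≢0 (suc m) n}}

  n<2^n : ∀ n → n < 2 ^ n
  n<2^n zero    = s≤s z≤n
  n<2^n (suc n) = begin
    1 + suc n        ≤⟨ ℕₚ.+-mono-≤ (ℕₚ.m^n>0 2 n) (n<2^n n) ⟩
    2 ^ n + 2 ^ n    ≡⟨ cong (2 ^ n +_) (ℕₚ.+-identityʳ (2 ^ n)) ⟨
    2 ^ suc n        ∎

  n²≤2^n : ∀ o → (4 + o) * (4 + o) ≤ 2 ^ (4 + o)
  n²≤2^n zero    = ℕₚ.≤-refl
  n²≤2^n (suc o) = begin
    (5 + o) * (5 + o)                         ≤⟨ ℕₚ.m≤m+n _ (7 + 6 * o + o * o) ⟩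
    (5 + o) * (5 + o) + (7 + 6 * o + o * o)   ≡⟨ ring o ⟩
    2 * ((4 + o) * (4 + o))                   ≤⟨ ℕₚ.*-monoʳ-≤ 2 (n²≤2^n o) ⟩
    2 ^ (5 + o)                               ∎
    where
    ring : ∀ o → (5 + o) * (5 + o) + (7 + 6 * o + o * o) ≡ 2 * ((4 + o) * (4 + o))
    ring = solve-∀

  -- Both A + B t ≤ (A + B) t ≤ t² and t² ≤ 2^t hold, the latter from t = 4 on.
  linear≤2^ : ∀ A B t → 4 + (A + B) ≤ t → A + B * t ≤ 2 ^ t
  linear≤2^ A B t ≤t with ℕₚ.m≤n⇒∃[o]m+o≡n ≤t
  ... | o , refl = begin
    A + B * t            ≤⟨ ℕₚ.+-monoˡ-≤ (B * t) (ℕₚ.m≤m*n A t) ⟩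
    A * t + B * t        ≡⟨ ℕₚ.*-distribʳ-+ t A B ⟨
    (A + B) * t          ≤⟨ ℕₚ.*-monoˡ-≤ t (ℕₚ.≤-trans (ℕₚ.m≤n+m (A + B) 4) ≤t) ⟩
    t * t                ≤⟨ n²≤2^n (A + B + o) ⟩
    2 ^ t                ∎

  -- The binomial coefficient of a + b over a is at most 2^(a + b); the induction is Pascal's rule.
  factorial-+ : ∀ a b → (a + b) ! ≤ 2 ^ (a + b) * (a ! * b !)
  factorial-+ zero    b = begin
    b !                          ≤⟨ ℕₚ.m≤n*m (b !) (2 ^ b) {{ℕₚ.m^n≢0 2 b}} ⟩
    2 ^ b * b !                  ≡⟨ cong (2 ^ b *_) (ℕₚ.*-identityˡ (b !)) ⟨
    2 ^ b * (1 * b !)            ∎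
  factorial-+ (suc a) zero = begin
    (suc a + 0) !                          ≡⟨ cong _! (ℕₚ.+-identityʳ (suc a)) ⟩
    suc a !                                ≤⟨ ℕₚ.m≤n*m (suc a !) (2 ^ (suc a + 0)) {{ℕₚ.m^n≢0 2 (suc a + 0)}} ⟩
    2 ^ (suc a + 0) * suc a !              ≡⟨ cong (2 ^ (suc a + 0) *_) (ℕₚ.*-identityʳ (suc a !)) ⟨
    2 ^ (suc a + 0) * (suc a ! * 1)        ∎
  factorial-+ (suc a) (suc b) = begin
    (suc a + suc b) * (a + suc b) !
      ≡⟨ ℕₚ.*-distribʳ-+ ((a + suc b) !) (suc a) (suc b) ⟩
    suc a * (a + suc b) ! + suc b * (a + suc b) !
      ≡⟨ cong (λ x → suc a * (a + suc b) ! + suc b * x !) (ℕₚ.+-suc a b) ⟩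
    suc a * (a + suc b) ! + suc b * (suc a + b) !
      ≤⟨ ℕₚ.+-mono-≤ (ℕₚ.*-monoʳ-≤ (suc a) (factorial-+ a (suc b))) (ℕₚ.*-monoʳ-≤ (suc b) (factorial-+ (suc a) b)) ⟩
    suc a * (2 ^ (a + suc b) * (a ! * suc b !)) + suc b * (2 ^ (suc a + b) * (suc a ! * b !))
      ≡⟨ cong (λ x → suc a * (2 ^ (a + suc b) * (a ! * suc b !)) + suc b * (2 ^ x * (suc a ! * b !))) (ℕₚ.+-suc a b) ⟨
    suc a * (2 ^ (a + suc b) * (a ! * suc b !)) + suc b * (2 ^ (a + suc b) * (suc a ! * b !))
      ≡⟨ ring a b (2 ^ (a + suc b)) (a !) (b !) ⟩
    2 ^ (suc a + suc b) * (suc a ! * suc b !) ∎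
    where
    ring : ∀ a b x f g → suc a * (x * (f * (suc b * g))) + suc b * (x * (suc a * f * g)) ≡ 2 * x * (suc a * f * (suc b * g))
    ring = solve-∀

  factorial-^ : ∀ b a → b ! * b ^ a ≤ (a + b) !
  factorial-^ b zero    = ℕₚ.≤-reflexive (ℕₚ.*-identityʳ (b !))
  factorial-^ b (suc a) = begin
    b ! * (b * b ^ a)       ≡⟨ ring (b !) b (b ^ a) ⟩
    b * (b ! * b ^ a)       ≤⟨ ℕₚ.*-mono-≤ (ℕₚ.m≤n+m b (suc a)) (factorial-^ b a) ⟩
    (suc a + b) * (a + b) ! ∎
    where
    ring : ∀ x y z → x * (y * z) ≡ y * (x * z)
    ring = solve-∀

  -- A weak Stirling bound, from estimating (2 k)! on both sides. The base 4 instead of e costs only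
  -- a factor C^k.
  k^k≤4^k*k! : ∀ k → k ^ k ≤ 4 ^ k * k !
  k^k≤4^k*k! k = ℕₚ.*-cancelˡ-≤ (k !) {{k ℕₚ.!≢0}} (begin
    k ! * k ^ k             ≤⟨ factorial-^ k k ⟩
    (k + k) !               ≤⟨ factorial-+ k k ⟩
    2 ^ (k + k) * (k ! * k !) ≡⟨ cong (_* (k ! * k !)) (trans (ℕₚ.^-distribˡ-+-* 2 k k) (sym (^-distribʳ-* k 2 2))) ⟩
    4 ^ k * (k ! * k !)     ≡⟨ ring (4 ^ k) (k !) ⟩
    k ! * (4 ^ k * k !)     ∎)
    where
    ring : ∀ x y → x * (y * y) ≡ y * (x * y)
    ring = solve-∀

  log-floor : ∀ y k .{{_ : NonZero k}} → 2 ≤ y → ∃[ t ] y ^ t ≤ k × k < y ^ suc t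
  log-floor y 1 2≤y = 0 , ℕₚ.≤-refl , ℕₚ.≤-trans 2≤y (ℕₚ.≤-reflexive (sym (ℕₚ.*-identityʳ y)))
  log-floor y (suc (suc k)) 2≤y with log-floor y (suc k) 2≤y
  ... | t , yᵗ≤k , k<yᵗ⁺¹ with suc (suc k) ℕₚ.<? y ^ suc t
  ...   | yes below = t , ℕₚ.m≤n⇒m≤1+n yᵗ≤k , below
  ...   | no  above = suc t , ℕₚ.≮⇒≥ above , ℕₚ.≤-<-trans k<yᵗ⁺¹
    (subst (y ^ suc t <_) (ℕₚ.*-comm (y ^ suc t) y)
      (ℕₚ.m<m*n (y ^ suc t) y {{ℕₚ.m^n≢0 y (suc t) {{ℕ.>-nonZero (ℕₚ.≤-trans (s≤s z≤n) 2≤y)}}}} 2≤y))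

  -- Three queries gain a factor 2, because (4/3)³ = 64/27 > 2.
  3^m*2^z≤4^m : ∀ m z → 3 * z ≤ m → 2 ^ z * 3 ^ m ≤ 4 ^ m
  3^m*2^z≤4^m m z 3z≤m with ℕₚ.m≤n⇒∃[o]m+o≡n 3z≤m
  ... | o , refl = begin
    2 ^ z * 3 ^ (3 * z + o)       ≡⟨ cong (2 ^ z *_) (ℕₚ.^-distribˡ-+-* 3 (3 * z) o) ⟩
    2 ^ z * (3 ^ (3 * z) * 3 ^ o) ≡⟨ cong (λ x → 2 ^ z * (x * 3 ^ o)) (ℕₚ.^-*-assoc 3 3 z) ⟨
    2 ^ z * (27 ^ z * 3 ^ o)      ≡⟨ ℕₚ.*-assoc (2 ^ z) (27 ^ z) (3 ^ o) ⟨
    2 ^ z * 27 ^ z * 3 ^ o        ≡⟨ cong (_* 3 ^ o) (^-distribʳ-* z 2 27) ⟨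
    54 ^ z * 3 ^ o                ≤⟨ ℕₚ.*-mono-≤ (ℕₚ.^-monoˡ-≤ z (ℕₚ.m≤m+n 54 10)) (ℕₚ.^-monoˡ-≤ o (ℕₚ.n≤1+n 3)) ⟩
    64 ^ z * 4 ^ o                ≡⟨ cong (_* 4 ^ o) (ℕₚ.^-*-assoc 4 3 z) ⟩
    4 ^ (3 * z) * 4 ^ o           ≡⟨ ℕₚ.^-distribˡ-+-* 4 (3 * z) o ⟨
    4 ^ (3 * z + o)               ∎

  ^-swap : ∀ x i j → (x ^ i) ^ j ≡ (x ^ j) ^ i
  ^-swap x i j = trans (ℕₚ.^-*-assoc x i j) (trans (cong (x ^_) (ℕₚ.*-comm i j)) (sym (ℕₚ.^-*-assoc x j i)))

  -- In the application k ≈ n^(a/b), m ≥ (P/Q) k and H is the inverse of the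
  -- admitted failure probability. With u = 2^t ≈ k^(1/r), d₀ is u^(r - 1).
  module _ (a b c P Q H : ℕ) .{{_ : NonZero a}} .{{_ : NonZero Q}} .{{_ : NonZero H}}
           (b≡a+c : b ≡ a + c) (gap : 2 * Q * c < P * a) where

    private
      W r r′ D C A B T N : ℕ
      -- The choice r = W + 2 leaves exactly one spare factor u: the left side of `base≤` is of
      -- order u^(r W), while `gap` gives P a ≥ W + 1, and r W + 1 = (W + 1)² ≤ (r - 1) P a.
      W  = 2 * Q * c
      r′ = suc W
      r  = suc r′
      -- `D` gathers the 4 of `k^k≤4^k*k!`, the factor 2 H, and k + 1 ≤ 2 k; `C` adds the rounding
      -- of k up to the next power of 2^r. `A` and `B` are the coefficients of the exponent in
      -- `near-asymptotics`. For t ≥ `T` the number u exceeds both A + B t and C, and n ≥ `N` forces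
      -- t ≥ `T`.
      D  = (8 * H) ^ a * 2 ^ b
      C  = (D * (2 ^ r) ^ c) ^ (2 * Q)
      A  = 3 * Q * (2 * (r * b + 1) + 2 * H)
      B  = 3 * Q * (2 * (r * b))
      T  = 4 + (A + B) + C
      N  = suc ((2 ^ r) ^ (T * b))

      instance
        P≢0 : NonZero P
        P≢0 = ℕₚ.m*n≢0⇒m≢0 P {a} {{ℕ.>-nonZero (ℕₚ.≤-<-trans z≤n gap)}}

      module _ {n k m t : ℕ} (n^a≤ : n ^ a ≤ suc k ^ b) (Pk≤Qm : P * k ≤ Q * m) .{{_ : NonZero k}}
               (lower : (2 ^ r) ^ t ≤ k) (upper : k < (2 ^ r) ^ suc t) (T≤t : T ≤ t) where

        u d₀ : ℕ
        u  = 2 ^ t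
        d₀ = u ^ r′

        d₀*u≤k : d₀ * u ≤ k
        d₀*u≤k = begin
          u ^ r′ * u     ≡⟨ ℕₚ.*-comm (u ^ r′) u ⟩
          u ^ r          ≡⟨ ^-swap 2 t r ⟩
          (2 ^ r) ^ t    ≤⟨ lower ⟩
          k              ∎

        sucn≤ : suc n ≤ 2 ^ (suc t * (r * b) + 1)
        sucn≤ = begin
          1 + n                            ≤⟨ ℕₚ.+-mono-≤ (ℕₚ.m^n>0 2 (suc t * (r * b))) n≤ ⟩
          2 ^ (suc t * (r * b)) + 2 ^ (suc t * (r * b))
            ≡⟨ cong (2 ^ (suc t * (r * b)) +_) (ℕₚ.+-identityʳ _) ⟨
          2 ^ suc (suc t * (r * b))        ≡⟨ cong (2 ^_) (ℕₚ.+-comm (suc t * (r * b)) 1) ⟨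
          2 ^ (suc t * (r * b) + 1)        ∎
          where
          ring : ∀ r t b → r * t * b ≡ t * (r * b)
          ring = solve-∀
          n≤ : n ≤ 2 ^ (suc t * (r * b))
          n≤ = begin
            n                        ≤⟨ m≤m^n n a ⟩
            n ^ a                    ≤⟨ n^a≤ ⟩
            suc k ^ b                ≤⟨ ℕₚ.^-monoˡ-≤ b upper ⟩
            ((2 ^ r) ^ suc t) ^ b    ≡⟨ cong (_^ b) (ℕₚ.^-*-assoc 2 r (suc t)) ⟩
            (2 ^ (r * suc t)) ^ b    ≡⟨ ℕₚ.^-*-assoc 2 (r * suc t) b ⟩
            2 ^ (r * suc t * b)      ≡⟨ cong (2 ^_) (ring r (suc t) b) ⟩
            2 ^ (suc t * (r * b))    ∎

        -- The logarithm of the left side, apart from 3^m, is d₀ times a linear function of t, since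
        -- ln n = O(t). The exponent m is at least of order k ≥ d₀ u, and u = 2^t beats every linear
        -- function of t.
        near-asymptotics : suc n ^ (d₀ + d₀) * (2 * H) * 3 ^ m ≤ 4 ^ m
        near-asymptotics = begin
          suc n ^ (d₀ + d₀) * (2 * H) * 3 ^ m
            ≤⟨ ℕₚ.*-monoˡ-≤ (3 ^ m) (ℕₚ.*-mono-≤ (ℕₚ.^-monoˡ-≤ (d₀ + d₀) sucn≤) 2H≤) ⟩
          (2 ^ e) ^ (d₀ + d₀) * 2 ^ (2 * H * d₀) * 3 ^ m
            ≡⟨ cong (λ x → x * 2 ^ (2 * H * d₀) * 3 ^ m) (ℕₚ.^-*-assoc 2 e (d₀ + d₀)) ⟩
          2 ^ (e * (d₀ + d₀)) * 2 ^ (2 * H * d₀) * 3 ^ m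
            ≡⟨ cong (_* 3 ^ m) (ℕₚ.^-distribˡ-+-* 2 (e * (d₀ + d₀)) (2 * H * d₀)) ⟨
          2 ^ z * 3 ^ m
            ≤⟨ 3^m*2^z≤4^m m z (ℕₚ.*-cancelˡ-≤ Q exponent) ⟩
          4 ^ m ∎
          where
          e z : ℕ
          e = suc t * (r * b) + 1
          z = e * (d₀ + d₀) + 2 * H * d₀
          -- Generous, but it makes the whole exponent `z` a multiple of `d₀`.
          2H≤ : 2 * H ≤ 2 ^ (2 * H * d₀)
          2H≤ = ℕₚ.≤-trans (ℕₚ.<⇒≤ (n<2^n (2 * H))) (ℕₚ.^-monoʳ-≤ 2 (ℕₚ.m≤m*n (2 * H) d₀ {{ℕₚ.m^n≢0 u r′ {{ℕₚ.m^n≢0 2 t}}}}))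
          ring : ∀ Q t s H d → Q * (3 * (((1 + t) * s + 1) * (d + d) + 2 * H * d))
            ≡ d * (3 * Q * (2 * (s + 1) + 2 * H) + 3 * Q * (2 * s) * t)
          ring = solve-∀
          exponent : Q * (3 * z) ≤ Q * m
          exponent = begin
            Q * (3 * z)        ≡⟨ ring Q t (r * b) H d₀ ⟩
            d₀ * (A + B * t)   ≤⟨ ℕₚ.*-monoʳ-≤ d₀ (linear≤2^ A B t (ℕₚ.m+n≤o⇒m≤o (4 + (A + B)) T≤t)) ⟩
            d₀ * u             ≤⟨ d₀*u≤k ⟩
            k                  ≤⟨ ℕₚ.m≤n*m k P ⟩
            P * k              ≤⟨ Pk≤Qm ⟩
            Q * m              ∎

        module _ (S : ℕ) (S*k!≤ : S * k ! ≤ n ^ k) where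

          x : ℕ
          x = S * (2 * H)

          x*k^k≤ : x * k ^ k ≤ (8 * H * n) ^ k
          x*k^k≤ = begin
            S * (2 * H) * k ^ k             ≤⟨ ℕₚ.*-mono-≤ (ℕₚ.*-monoʳ-≤ S (m≤m^n (2 * H) k)) (k^k≤4^k*k! k) ⟩
            S * (2 * H) ^ k * (4 ^ k * k !) ≡⟨ ring S ((2 * H) ^ k) (4 ^ k) (k !) ⟩
            4 ^ k * (2 * H) ^ k * (S * k !) ≤⟨ ℕₚ.*-monoʳ-≤ (4 ^ k * (2 * H) ^ k) S*k!≤ ⟩
            4 ^ k * (2 * H) ^ k * n ^ k     ≡⟨ cong (_* n ^ k) (^-distribʳ-* k 4 (2 * H)) ⟨
            (4 * (2 * H)) ^ k * n ^ k       ≡⟨ ^-distribʳ-* k (4 * (2 * H)) n ⟨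
            (4 * (2 * H) * n) ^ k           ≡⟨ cong (λ y → (y * n) ^ k) (ℕₚ.*-assoc 4 2 H) ⟨
            (8 * H * n) ^ k                 ∎
            where
            ring : ∀ S h f g → S * h * (f * g) ≡ f * h * (S * g)
            ring = solve-∀

          -- Because b = a + c, the bound on n^a says that n/k is at most of order k^(c/a). The
          -- power a keeps the exponents natural, and cancelling (k^k)^a performs the division of
          -- n^k by k^k.
          x^a≤ : x ^ a ≤ (D * k ^ c) ^ k
          x^a≤ = ℕₚ.*-cancelʳ-≤ _ _ ((k ^ k) ^ a) {{ℕₚ.m^n≢0 (k ^ k) a {{ℕₚ.m^n≢0 k k}}}} (begin
            x ^ a * (k ^ k) ^ a              ≡⟨ ^-distribʳ-* a x (k ^ k) ⟨
            (x * k ^ k) ^ a                  ≤⟨ ℕₚ.^-monoˡ-≤ a x*k^k≤ ⟩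
            ((8 * H * n) ^ k) ^ a            ≡⟨ ^-swap (8 * H * n) k a ⟩
            ((8 * H * n) ^ a) ^ k            ≡⟨ cong (_^ k) (^-distribʳ-* a (8 * H) n) ⟩
            ((8 * H) ^ a * n ^ a) ^ k        ≤⟨ ℕₚ.^-monoˡ-≤ k (ℕₚ.*-monoʳ-≤ ((8 * H) ^ a) n^a≤2k) ⟩
            ((8 * H) ^ a * (2 ^ b * (k ^ a * k ^ c))) ^ k
              ≡⟨ cong (_^ k) (ring ((8 * H) ^ a) (2 ^ b) (k ^ a) (k ^ c)) ⟩
            (D * k ^ c * k ^ a) ^ k          ≡⟨ ^-distribʳ-* k (D * k ^ c) (k ^ a) ⟩
            (D * k ^ c) ^ k * (k ^ a) ^ k    ≡⟨ cong ((D * k ^ c) ^ k *_) (^-swap k a k) ⟩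
            (D * k ^ c) ^ k * (k ^ k) ^ a    ∎)
            where
            ring : ∀ f g h i → f * (g * (h * i)) ≡ f * g * i * h
            ring = solve-∀
            n^a≤2k : n ^ a ≤ 2 ^ b * (k ^ a * k ^ c)
            n^a≤2k = begin
              n ^ a                      ≤⟨ n^a≤ ⟩
              suc k ^ b                  ≤⟨ ℕₚ.^-monoˡ-≤ b (ℕₚ.+-mono-≤ (ℕ.>-nonZero⁻¹ k) (ℕₚ.≤-reflexive (sym (ℕₚ.+-identityʳ k)))) ⟩
              (2 * k) ^ b                ≡⟨ ^-distribʳ-* b 2 k ⟩
              2 ^ b * k ^ b              ≡⟨ cong (λ y → 2 ^ b * k ^ y) b≡a+c ⟩
              2 ^ b * k ^ (a + c)        ≡⟨ cong (2 ^ b *_) (ℕₚ.^-distribˡ-+-* k a c) ⟩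
              2 ^ b * (k ^ a * k ^ c)    ∎

          -- The heart of the far estimate: (n/k)^k against d₀^(m/2), with the k-th root taken and
          -- the denominators a and Q cleared. The spare factor u absorbs the constant C.
          base≤ : (D * k ^ c) ^ (2 * Q) ≤ d₀ ^ (P * a)
          base≤ = begin
            (D * k ^ c) ^ (2 * Q)
              ≤⟨ ℕₚ.^-monoˡ-≤ (2 * Q) (ℕₚ.*-monoʳ-≤ D (ℕₚ.^-monoˡ-≤ c (ℕₚ.<⇒≤ upper))) ⟩
            (D * ((2 ^ r) * (2 ^ r) ^ t) ^ c) ^ (2 * Q)
              ≡⟨ cong (λ y → (D * y) ^ (2 * Q)) (^-distribʳ-* c (2 ^ r) ((2 ^ r) ^ t)) ⟩
            (D * ((2 ^ r) ^ c * ((2 ^ r) ^ t) ^ c)) ^ (2 * Q)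
              ≡⟨ cong (_^ (2 * Q)) (ℕₚ.*-assoc D _ _) ⟨
            (D * (2 ^ r) ^ c * ((2 ^ r) ^ t) ^ c) ^ (2 * Q)
              ≡⟨ ^-distribʳ-* (2 * Q) (D * (2 ^ r) ^ c) (((2 ^ r) ^ t) ^ c) ⟩
            C * (((2 ^ r) ^ t) ^ c) ^ (2 * Q)
              ≤⟨ ℕₚ.*-monoˡ-≤ _ C≤u ⟩
            u * (((2 ^ r) ^ t) ^ c) ^ (2 * Q)
              ≡⟨ cong (λ y → u * (y ^ c) ^ (2 * Q)) (^-swap 2 r t) ⟩
            u * ((u ^ r) ^ c) ^ (2 * Q)
              ≡⟨ cong (u *_) (trans (cong (_^ (2 * Q)) (ℕₚ.^-*-assoc u r c)) (ℕₚ.^-*-assoc u (r * c) (2 * Q))) ⟩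
            u ^ suc (r * c * (2 * Q))
              ≤⟨ ℕₚ.^-monoʳ-≤ u {{ℕₚ.m^n≢0 2 t}} exponent ⟩
            u ^ (r′ * (P * a))
              ≡⟨ ℕₚ.^-*-assoc u r′ (P * a) ⟨
            d₀ ^ (P * a) ∎
            where
            C≤u : C ≤ u
            C≤u = ℕₚ.≤-trans (ℕₚ.m+n≤o⇒n≤o (4 + (A + B)) T≤t) (ℕₚ.<⇒≤ (n<2^n t))
            ring : ∀ Q c → 1 + ((2 + 2 * Q * c) * c * (2 * Q)) ≡ (1 + 2 * Q * c) * (1 + 2 * Q * c)
            ring = solve-∀
            exponent : suc (r * c * (2 * Q)) ≤ r′ * (P * a)
            exponent = begin
              suc (r * c * (2 * Q))  ≡⟨ ring Q c ⟩
              r′ * suc W             ≤⟨ ℕₚ.*-monoʳ-≤ r′ gap ⟩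
              r′ * (P * a)           ∎

          far-asymptotics : x * x ≤ d₀ ^ m
          far-asymptotics = ^-cancelˡ-≤ (a * Q) {{ℕₚ.m*n≢0 a Q}} (begin
            (x * x) ^ (a * Q)
              ≡⟨ cong (_^ (a * Q)) (cong (x *_) (ℕₚ.*-identityʳ x)) ⟨
            (x ^ 2) ^ (a * Q)
              ≡⟨ trans (ℕₚ.^-*-assoc x 2 (a * Q)) (trans (cong (x ^_) (ring₁ a Q)) (sym (ℕₚ.^-*-assoc x a (2 * Q)))) ⟩
            (x ^ a) ^ (2 * Q)
              ≤⟨ ℕₚ.^-monoˡ-≤ (2 * Q) x^a≤ ⟩
            ((D * k ^ c) ^ k) ^ (2 * Q)
              ≡⟨ ^-swap (D * k ^ c) k (2 * Q) ⟩
            ((D * k ^ c) ^ (2 * Q)) ^ k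
              ≤⟨ ℕₚ.^-monoˡ-≤ k base≤ ⟩
            (d₀ ^ (P * a)) ^ k
              ≡⟨ trans (ℕₚ.^-*-assoc d₀ (P * a) k) (cong (d₀ ^_) (ring₂ P a k)) ⟩
            d₀ ^ (P * k * a)
              ≤⟨ ℕₚ.^-monoʳ-≤ d₀ {{ℕₚ.m^n≢0 u r′ {{ℕₚ.m^n≢0 2 t}}}} (ℕₚ.*-monoˡ-≤ a Pk≤Qm) ⟩
            d₀ ^ (Q * m * a)
              ≡⟨ trans (cong (d₀ ^_) (ring₃ Q m a)) (sym (ℕₚ.^-*-assoc d₀ m (a * Q))) ⟩
            (d₀ ^ m) ^ (a * Q) ∎)
            where
            ring₁ : ∀ a Q → 2 * (a * Q) ≡ a * (2 * Q)
            ring₁ = solve-∀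
            ring₂ : ∀ P a k → P * a * k ≡ P * k * a
            ring₂ = solve-∀
            ring₃ : ∀ Q m a → Q * m * a ≡ m * (a * Q)
            ring₃ = solve-∀

    asymptotics : ∃[ N ] ∀ n k m → N ≤ n → n ^ a ≤ suc k ^ b → P * k ≤ Q * m →
      ∃[ d₀ ] suc n ^ (d₀ + d₀) * (2 * H) * 3 ^ m ≤ 4 ^ m
            × (∀ S → S * k ! ≤ n ^ k → S * (2 * H) * (S * (2 * H)) ≤ d₀ ^ m)
    asymptotics = N , λ n k m N≤n n^a≤ Pk≤Qm → eventually n k m N≤n n^a≤ Pk≤Qm
      where
      eventually : ∀ n k m → N ≤ n → n ^ a ≤ suc k ^ b → P * k ≤ Q * m →
        ∃[ d₀ ] suc n ^ (d₀ + d₀) * (2 * H) * 3 ^ m ≤ 4 ^ m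
              × (∀ S → S * k ! ≤ n ^ k → S * (2 * H) * (S * (2 * H)) ≤ d₀ ^ m)
      eventually n zero m N≤n n^a≤ _ = contradiction (begin
        2                             ≤⟨ s≤s (ℕₚ.m^n>0 (2 ^ r) {{ℕₚ.m^n≢0 2 r}} (T * b)) ⟩
        N                             ≤⟨ N≤n ⟩
        n                             ≤⟨ m≤m^n n a ⟩
        n ^ a                         ≤⟨ n^a≤ ⟩
        1 ^ b                         ≡⟨ ℕₚ.^-zeroˡ b ⟩
        1                             ∎) λ { (s≤s ()) }
      eventually n k@(suc _) m N≤n n^a≤ Pk≤Qm with log-floor (2 ^ r) k (m≤m^n 2 r)
      ... | t , lower , upper with T ℕₚ.≤? t
      ...   | yes T≤t = _ , near-asymptotics n^a≤ Pk≤Qm lower upper T≤t , far-asymptotics n^a≤ Pk≤Qm lower upper T≤t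
      ...   | no  T≰t = contradiction (begin
        N                              ≤⟨ N≤n ⟩
        n                              ≤⟨ m≤m^n n a ⟩
        n ^ a                          ≤⟨ n^a≤ ⟩
        suc k ^ b                      ≤⟨ ℕₚ.^-monoˡ-≤ b upper ⟩
        ((2 ^ r) ^ suc t) ^ b          ≤⟨ ℕₚ.^-monoˡ-≤ b (ℕₚ.^-monoʳ-≤ (2 ^ r) {{ℕₚ.m^n≢0 2 r}} (ℕₚ.≰⇒> T≰t)) ⟩
        ((2 ^ r) ^ T) ^ b              ≡⟨ ℕₚ.^-*-assoc (2 ^ r) T b ⟩
        (2 ^ r) ^ (T * b)              ∎) (ℕₚ.<⇒≱ (ℕₚ.n<1+n _))

-- From Dedekind cuts to exponents in natural numbers.

module Cuts where
  import Algebra.Definitions.RawSemiring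
  open import Data.Integer using (+_)
  open import Data.Nat.Tactic.RingSolver using (solve-∀)
  open import Data.Rational using (mkℚ; _+_; _*_; -_; _≤_; _<_; toℚᵘ)
  open import Data.Rational.Properties using (≤-refl; ≤-trans; <⇒≤)
  open import Data.Rational.Unnormalised as ℚᵘ using (mkℚᵘ)
  import Data.Rational.Unnormalised.Properties as ℚᵘₚ
  open Algebra.Definitions.RawSemiring ℚ.+-*-rawSemiring using (_^_)
  open +-*-Solver using (solve; _:+_; _:*_; :-_; con; _:=_)
  open Asymptotics using (^-cancelˡ-≤; ^-swap)

  <⇒≱ : ∀ {p q} → p < q → ¬ q ≤ p
  <⇒≱ p<q q≤p = ℚₚ.<-irrefl refl (ℚₚ.<-≤-trans p<q q≤p)

  *-cancelʳ-≡-pos : ∀ {p q} r → 0ℚ < r → p * r ≡ q * r → p ≡ q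
  *-cancelʳ-≡-pos r 0<r pr≡qr = ℚₚ.≤-antisym
    (ℚₚ.*-cancelʳ-≤-pos r {{ℚ.positive 0<r}} (ℚₚ.≤-reflexive pr≡qr))
    (ℚₚ.*-cancelʳ-≤-pos r {{ℚ.positive 0<r}} (ℚₚ.≤-reflexive (sym pr≡qr)))

  toℚᵘ-/ : ∀ i d → toℚᵘ (i ℚ./ suc d) ℚᵘ.≃ mkℚᵘ i d
  toℚᵘ-/ i d = ℚₚ.toℚᵘ-fromℚᵘ (mkℚᵘ i d)

  /-*-cancel : ∀ p d .{{_ : ℕ.NonZero d}} → (+ p ℚ./ d) * ℕ→ℚ d ≡ ℕ→ℚ p
  /-*-cancel p d@(suc d-1) = ℚₚ.toℚᵘ-injective (begin
    toℚᵘ ((+ p ℚ./ d) * ℕ→ℚ d)            ≈⟨ ℚₚ.toℚᵘ-homo-* (+ p ℚ./ d) (ℕ→ℚ d) ⟩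
    toℚᵘ (+ p ℚ./ d) ℚᵘ.* toℚᵘ (ℕ→ℚ d)    ≈⟨ ℚᵘₚ.*-cong (toℚᵘ-/ (+ p) d-1) (toℚᵘ-/ (+ d) 0) ⟩
    mkℚᵘ (+ p) d-1 ℚᵘ.* mkℚᵘ (+ d) 0      ≈⟨ ℚᵘ.*≡* (ℤₚ.*-assoc (+ p) (+ d) (+ 1)) ⟩
    mkℚᵘ (+ p) 0                          ≈⟨ toℚᵘ-/ (+ p) 0 ⟨
    toℚᵘ (ℕ→ℚ p)                          ∎)
    where open ℚᵘₚ.≃-Reasoning

  ↥↧-cancel : ∀ {t} → 0ℚ < t → t * ℕ→ℚ (↧ₙ t) ≡ ℕ→ℚ ℤ.∣ ↥ t ∣
  ↥↧-cancel {t@(mkℚ (+ p) d _)} _ = trans (cong (_* ℕ→ℚ (suc d)) (sym (ℚₚ.↥p/↧p≡p t))) (/-*-cancel p (suc d))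
  ↥↧-cancel {mkℚ -[1+ p ] d c} 0<t = contradiction (ℚₚ.negative⁻¹ (mkℚ -[1+ p ] d c)) (ℚₚ.<-asym 0<t)

  ℕ→ℚ-+ : ∀ m n → ℕ→ℚ (m ℕ.+ n) ≡ ℕ→ℚ m + ℕ→ℚ n
  ℕ→ℚ-+ m n = ℚₚ.toℚᵘ-injective (begin
    toℚᵘ (ℕ→ℚ (m ℕ.+ n))               ≈⟨ toℚᵘ-/ (+ (m ℕ.+ n)) 0 ⟩
    mkℚᵘ (+ (m ℕ.+ n)) 0               ≈⟨ ℚᵘ.*≡* (cong (ℤ._* + 1) (sym (cong₂ ℤ._+_ (ℤₚ.*-identityʳ (+ m)) (ℤₚ.*-identityʳ (+ n))))) ⟩
    mkℚᵘ (+ m) 0 ℚᵘ.+ mkℚᵘ (+ n) 0     ≈⟨ ℚᵘₚ.+-cong (toℚᵘ-/ (+ m) 0) (toℚᵘ-/ (+ n) 0) ⟨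
    toℚᵘ (ℕ→ℚ m) ℚᵘ.+ toℚᵘ (ℕ→ℚ n)     ≈⟨ ℚₚ.toℚᵘ-homo-+ (ℕ→ℚ m) (ℕ→ℚ n) ⟨
    toℚᵘ (ℕ→ℚ m + ℕ→ℚ n)               ∎)
    where open ℚᵘₚ.≃-Reasoning

  ℕ→ℚ-* : ∀ m n → ℕ→ℚ (m ℕ.* n) ≡ ℕ→ℚ m * ℕ→ℚ n
  ℕ→ℚ-* m n = ℚₚ.toℚᵘ-injective (begin
    toℚᵘ (ℕ→ℚ (m ℕ.* n))               ≈⟨ toℚᵘ-/ (+ (m ℕ.* n)) 0 ⟩
    mkℚᵘ (+ (m ℕ.* n)) 0               ≈⟨ ℚᵘ.*≡* (cong (ℤ._* + 1) (ℤₚ.pos-* m n)) ⟩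
    mkℚᵘ (+ m) 0 ℚᵘ.* mkℚᵘ (+ n) 0     ≈⟨ ℚᵘₚ.*-cong (toℚᵘ-/ (+ m) 0) (toℚᵘ-/ (+ n) 0) ⟨
    toℚᵘ (ℕ→ℚ m) ℚᵘ.* toℚᵘ (ℕ→ℚ n)     ≈⟨ ℚₚ.toℚᵘ-homo-* (ℕ→ℚ m) (ℕ→ℚ n) ⟨
    toℚᵘ (ℕ→ℚ m * ℕ→ℚ n)               ∎)
    where open ℚᵘₚ.≃-Reasoning

  ℕ→ℚ-^ : ∀ m e → ℕ→ℚ (m ℕ.^ e) ≡ ℕ→ℚ m ^ e
  ℕ→ℚ-^ m zero    = refl
  ℕ→ℚ-^ m (suc e) = trans (ℕ→ℚ-* m (m ℕ.^ e)) (cong (ℕ→ℚ m *_) (ℕ→ℚ-^ m e))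

  ℕ→ℚ-mono-< : ∀ {m n} → m ℕ.< n → ℕ→ℚ m < ℕ→ℚ n
  ℕ→ℚ-mono-< {m} {n} m<n = ℚₚ.toℚᵘ-cancel-< (ℚᵘₚ.<-respˡ-≃ (ℚᵘₚ.≃-sym (toℚᵘ-/ (+ m) 0))
    (ℚᵘₚ.<-respʳ-≃ (ℚᵘₚ.≃-sym (toℚᵘ-/ (+ n) 0)) (ℚᵘ.*<* (ℤₚ.*-monoʳ-<-pos (+ 1) (ℤ.+<+ m<n)))))

  ℕ→ℚ-mono-≤ : ∀ {m n} → m ℕ.≤ n → ℕ→ℚ m ≤ ℕ→ℚ n
  ℕ→ℚ-mono-≤ m≤n with ℕₚ.m≤n⇒m<n∨m≡n m≤n
  ... | inj₁ m<n  = <⇒≤ (ℕ→ℚ-mono-< m<n)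
  ... | inj₂ refl = ≤-refl

  ℕ→ℚ-cancel-≤ : ∀ {m n} → ℕ→ℚ m ≤ ℕ→ℚ n → m ℕ.≤ n
  ℕ→ℚ-cancel-≤ m≤n = ℕₚ.≮⇒≥ λ n<m → <⇒≱ (ℕ→ℚ-mono-< n<m) m≤n

  ℕ→ℚ-cancel-< : ∀ {m n} → ℕ→ℚ m < ℕ→ℚ n → m ℕ.< n
  ℕ→ℚ-cancel-< m<n = ℕₚ.≰⇒> λ n≤m → <⇒≱ m<n (ℕ→ℚ-mono-≤ n≤m)

  ℕ→ℚ-nonNeg : ∀ n → 0ℚ ≤ ℕ→ℚ n
  ℕ→ℚ-nonNeg n = ℕ→ℚ-mono-≤ {0} {n} z≤n

  ℕ→ℚ-pos : ∀ n .{{_ : ℕ.NonZero n}} → 0ℚ < ℕ→ℚ n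
  ℕ→ℚ-pos n = ℕ→ℚ-mono-< {0} {n} (ℕ.>-nonZero⁻¹ n)

  ℕ→ℚ-suc : ∀ n → ℕ→ℚ n + ℕ→ℚ 1 ≡ ℕ→ℚ (suc n)
  ℕ→ℚ-suc n = trans (sym (ℕ→ℚ-+ n 1)) (cong ℕ→ℚ (ℕₚ.+-comm n 1))

  *-mono-≤ : ∀ {a b c d} → 0ℚ ≤ a → a ≤ b → 0ℚ ≤ c → c ≤ d → a * c ≤ b * d
  *-mono-≤ {a} {b} {c} {d} 0≤a a≤b 0≤c c≤d = ≤-trans
    (ℚₚ.*-monoˡ-≤-nonNeg a {{ℚ.nonNegative 0≤a}} c≤d)
    (ℚₚ.*-monoʳ-≤-nonNeg d {{ℚ.nonNegative (≤-trans 0≤c c≤d)}} a≤b)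

  *-nonNeg : ∀ {a b} → 0ℚ ≤ a → 0ℚ ≤ b → 0ℚ ≤ a * b
  *-nonNeg {a} {b} 0≤a 0≤b = subst (_≤ a * b) (ℚₚ.*-zeroˡ 0ℚ) (*-mono-≤ ≤-refl 0≤a ≤-refl 0≤b)

  ^-nonNeg : ∀ {x} → 0ℚ ≤ x → ∀ e → 0ℚ ≤ x ^ e
  ^-nonNeg 0≤x zero    = <⇒≤ (ℚₚ.positive⁻¹ 1ℚ)
  ^-nonNeg 0≤x (suc e) = *-nonNeg 0≤x (^-nonNeg 0≤x e)

  ^-mono-≤ : ∀ {x y} → 0ℚ ≤ x → x ≤ y → ∀ e → x ^ e ≤ y ^ e
  ^-mono-≤ 0≤x x≤y zero    = ≤-refl
  ^-mono-≤ 0≤x x≤y (suc e) = *-mono-≤ 0≤x x≤y (^-nonNeg 0≤x e) (^-mono-≤ 0≤x x≤y e)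

  ^-pos : ∀ {x} → 0ℚ < x → ∀ e → 0ℚ < x ^ e
  ^-pos 0<x zero    = ℚₚ.positive⁻¹ 1ℚ
  ^-pos {x} 0<x (suc e) = ℚₚ.positive⁻¹ (x * x ^ e) {{ℚₚ.pos*pos⇒pos x {{ℚ.positive 0<x}} (x ^ e) {{ℚ.positive (^-pos 0<x e)}}}}

  ^-mono-< : ∀ {x y} → 0ℚ ≤ x → x < y → ∀ e → x ^ suc e < y ^ suc e
  ^-mono-< {x} {y} 0≤x x<y e = ℚₚ.≤-<-trans
    (ℚₚ.*-monoˡ-≤-nonNeg x {{ℚ.nonNegative 0≤x}} (^-mono-≤ 0≤x (<⇒≤ x<y) e))
    (ℚₚ.*-monoˡ-<-pos (y ^ e) {{ℚ.positive (^-pos (ℚₚ.≤-<-trans 0≤x x<y) e)}} x<y)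

  numerator-expand : ∀ {x p} d e → x * ℕ→ℚ d ≡ ℕ→ℚ p → x * ℕ→ℚ (d ℕ.* e) ≡ ℕ→ℚ (p ℕ.* e)
  numerator-expand {x} {p} d e xd≡p = trans (cong (x *_) (ℕ→ℚ-* d e)) (trans (sym (ℚₚ.*-assoc x (ℕ→ℚ d) (ℕ→ℚ e)))
    (trans (cong (_* ℕ→ℚ e) xd≡p) (sym (ℕ→ℚ-* p e))))

  -- Here x = p/d and y = q/e, not necessarily in lowest terms.
  module _ {x y : ℚ} {p q : ℕ} (d e : ℕ) .{{_ : ℕ.NonZero d}} .{{_ : ℕ.NonZero e}}
           (xd≡p : x * ℕ→ℚ d ≡ ℕ→ℚ p) (ye≡q : y * ℕ→ℚ e ≡ ℕ→ℚ q) where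

    private
      left : x * ℕ→ℚ (d ℕ.* e) ≡ ℕ→ℚ (p ℕ.* e)
      left = numerator-expand {x} {p} d e xd≡p
      right : y * ℕ→ℚ (d ℕ.* e) ≡ ℕ→ℚ (q ℕ.* d)
      right = trans (cong (λ x → y * ℕ→ℚ x) (ℕₚ.*-comm d e)) (numerator-expand {y} {q} e d ye≡q)

    cross-< : x < y → p ℕ.* e ℕ.< q ℕ.* d
    cross-< x<y = ℕ→ℚ-cancel-< (subst₂ _<_ left right
      (ℚₚ.*-monoˡ-<-pos (ℕ→ℚ (d ℕ.* e)) {{ℚ.positive (ℕ→ℚ-pos (d ℕ.* e) {{ℕₚ.m*n≢0 d e}})}} x<y))

    uncross-< : p ℕ.* e ℕ.< q ℕ.* d → x < y
    uncross-< pe<qd = ℚₚ.*-cancelʳ-<-nonNeg (ℕ→ℚ (d ℕ.* e)) {{ℚ.nonNegative (ℕ→ℚ-nonNeg (d ℕ.* e))}}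
      (subst₂ _<_ (sym left) (sym right) (ℕ→ℚ-mono-< pe<qd))

  /-mono-< : ∀ {p q} d .{{_ : ℕ.NonZero d}} → p ℕ.< q → + p ℚ./ d < + q ℚ./ d
  /-mono-< {p} {q} d p<q = ℚₚ.*-cancelʳ-<-nonNeg (ℕ→ℚ d) {{ℚ.nonNegative (ℕ→ℚ-nonNeg d)}}
    (subst₂ _<_ (sym (/-*-cancel p d)) (sym (/-*-cancel q d)) (ℕ→ℚ-mono-< p<q))

  lower<upper : ∀ {x} → IsDedekind x → ∀ {p q} → Lower x p → Upper x q → p < q
  lower<upper x-dedekind {p} {q} p∈ q∈ with ℚₚ.<-cmp p q
  ... | tri< p<q _ _  = p<q
  ... | tri≈ _ refl _ = contradiction (p∈ , q∈) (IsDedekind.disjoint x-dedekind p)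
  ... | tri> _ _ q<p  = contradiction
    (Equivalence.from (IsDedekind.lower-rounded x-dedekind q) (p , q<p , p∈) , q∈) (IsDedekind.disjoint x-dedekind q)

  infix 4 _≲_

  -- The order p ≤ x, tested on the upper cut alone. In this form it passes through sums and
  -- products of arbitrary cuts, and the Dedekind properties enter only at the leaves θ and ε.
  _≲_ : ℚ → Cut → Set
  p ≲ x = ∀ q → Upper x q → p ≤ q

  ≲-fromℚ : ∀ p → p ≲ fromℚ p
  ≲-fromℚ p q p<q = <⇒≤ p<q

  ≲-lower : ∀ {x p} → IsDedekind x → Lower x p → p ≲ x
  ≲-lower x-dedekind p∈ q q∈ = <⇒≤ (lower<upper x-dedekind p∈ q∈)

  ≲-+ : ∀ {p q x y} → p ≲ x → q ≲ y → p + q ≲ x +ʳ y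
  ≲-+ p≲x q≲y r (a , b , a∈ , b∈ , a+b<r) = ≤-trans (ℚₚ.+-mono-≤ (p≲x a a∈) (q≲y b b∈)) (<⇒≤ a+b<r)

  ≲-neg : ∀ {x v} → IsDedekind x → Upper x v → - v ≲ -ʳ x
  ≲-neg {x} {v} x-dedekind v∈ q q∈ = subst (- v ≤_) (solve 1 (λ x → :- (:- x) := x) refl q)
    (ℚₚ.neg-antimono-≤ (<⇒≤ (lower<upper x-dedekind q∈ v∈)))

  -- The upper bound of an interval product dominates all four corners, in particular the product b
  -- d of the upper ends, and b ≥ p, d ≥ q.
  ≲-* : ∀ {p q x y} → 0ℚ ≤ p → 0ℚ ≤ q → p ≲ x → q ≲ y → p * q ≲ x *ʳ y
  ≲-* 0≤p 0≤q p≲x q≲y r (a , b , c , d , (_ , b∈ , _ , d∈) , max<r) = ≤-trans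
    (*-mono-≤ 0≤p (p≲x b b∈) 0≤q (q≲y d d∈))
    (≤-trans (≤-trans (ℚₚ.p≤q⊔p (b * c) (b * d)) (ℚₚ.p≤q⊔p ((a * c) ℚ.⊔ (a * d)) ((b * c) ℚ.⊔ (b * d)))) (<⇒≤ max<r))

  ≲-⁻¹ : ∀ {x v g} → IsDedekind x → Upper x v → 0ℚ < v → g * v ≡ 1ℚ → g ≲ x ⁻¹ʳ
  ≲-⁻¹ {x} {v} {g} x-dedekind v∈ 0<v gv≡1 q (r , 0<r , r∈ , 1<qr) = ℚₚ.*-cancelʳ-≤-pos v {{ℚ.positive 0<v}}
    (subst (_≤ q * v) (sym gv≡1) (≤-trans (<⇒≤ 1<qr)
      (ℚₚ.*-monoˡ-≤-nonNeg q {{ℚ.nonNegative (<⇒≤ 0<q)}} (<⇒≤ (lower<upper x-dedekind r∈ v∈)))))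
    where
    0<q : 0ℚ < q
    0<q = ℚₚ.*-cancelʳ-<-nonNeg r {{ℚ.nonNegative (<⇒≤ 0<r)}}
      (subst (_< q * r) (sym (ℚₚ.*-zeroˡ r)) (ℚₚ.<-trans (ℚₚ.positive⁻¹ 1ℚ) 1<qr))

  ≲-<ʳ : ∀ {p x} n → p ≲ x → x <ʳ fromℕ n → p ≤ ℕ→ℚ n
  ≲-<ʳ n p≲x (q , q∈ , q<n) = ≤-trans (p≲x q q∈) (<⇒≤ q<n)

  ≲-<ʳ-suc : ∀ {p x} n → p ≲ x → x <ʳ fromℕ n +ʳ fromℕ 1 → p < ℕ→ℚ (suc n)
  ≲-<ʳ-suc n p≲x (q , q∈ , a , b , a<n , b<1 , q<a+b) = subst (_ <_) (ℕ→ℚ-suc n)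
    (ℚₚ.≤-<-trans (p≲x q q∈) (ℚₚ.<-trans q<a+b (ℚₚ.+-mono-< a<n b<1)))

  -- This is the condition of `anticoncentration`. Its walk has one step more than the query, which
  -- makes rounding n/2 down harmless.
  half-rounding : ∀ n Γ → Rounds Γ (fromℕ n *ʳ fromℚ ½) → n ℕ.≤ 2 ℕ.* suc Γ
  half-rounding n Γ (_ , n/2<Γ+1) = ℕ→ℚ-cancel-≤ (subst₂ _≤_ left right
    (ℚₚ.*-monoˡ-≤-nonNeg (ℕ→ℚ 2) (<⇒≤ (≲-<ʳ-suc {ℕ→ℚ n * ½} {fromℕ n *ʳ fromℚ ½} Γ n/2≲ n/2<Γ+1))))
    where
    n/2≲ : ℕ→ℚ n * ½ ≲ fromℕ n *ʳ fromℚ ½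
    n/2≲ = ≲-* {ℕ→ℚ n} {½} {fromℕ n} {fromℚ ½} (ℕ→ℚ-nonNeg n) (<⇒≤ (ℚₚ.positive⁻¹ ½)) (≲-fromℚ (ℕ→ℚ n)) (≲-fromℚ ½)
    left : ℕ→ℚ 2 * (ℕ→ℚ n * ½) ≡ ℕ→ℚ n
    left = trans (cong (ℕ→ℚ 2 *_) (ℚₚ.*-comm (ℕ→ℚ n) ½)) (trans (sym (ℚₚ.*-assoc (ℕ→ℚ 2) ½ (ℕ→ℚ n))) (ℚₚ.*-identityˡ (ℕ→ℚ n)))
    right : ℕ→ℚ 2 * ℕ→ℚ (suc Γ) ≡ ℕ→ℚ (2 ℕ.* suc Γ)
    right = sym (ℕ→ℚ-* 2 (suc Γ))

  module _ {θ : Cut} (θ-dedekind : IsDedekind θ) where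

    -- Ensures that signals of weight `k` exist, since `Pr` is 0 on an empty list of outcomes.
    -- Rounding gives k < n^θ + 1, and n^θ ≤ n because θ < 1.
    power-rounding-≤ : ∀ n k .{{_ : ℕ.NonZero n}} → θ <ʳ fromℕ 1 → Rounds k (n ^ʳ θ) → k ℕ.≤ n
    power-rounding-≤ n k (v , v∈ , v<1) ((q , k<q , x , y , (t , s , 0<t , t∈ , 0≤s , s^d≤n^p , x<s) , y<1 , q<x+y) , _) =
      ℕₚ.≤-pred (ℕ→ℚ-cancel-< (subst (ℕ→ℚ k <_) (ℕ→ℚ-suc n)
        (ℚₚ.<-trans k<q (ℚₚ.<-trans q<x+y (ℚₚ.+-mono-< (ℚₚ.<-≤-trans x<s s≤n) y<1)))))
      where
      d p : ℕ
      d = ↧ₙ t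
      p = ℤ.∣ ↥ t ∣
      p<d : p ℕ.< d
      p<d = subst₂ ℕ._<_ (ℕₚ.*-identityʳ p) (ℕₚ.*-identityˡ d)
        (cross-< {p = p} {q = 1} d 1 (↥↧-cancel 0<t) refl (ℚₚ.<-trans (lower<upper θ-dedekind t∈ v∈) v<1))
      s≤n : s ≤ ℕ→ℚ n
      s≤n with s ℚₚ.≤? ℕ→ℚ n
      ... | yes s≤n = s≤n
      ... | no  s≰n = contradiction
        (≤-trans s^d≤n^p (subst₂ _≤_ (ℕ→ℚ-^ n p) (ℕ→ℚ-^ n d) (ℕ→ℚ-mono-≤ (ℕₚ.^-monoʳ-≤ n (ℕₚ.<⇒≤ p<d)))))
        (<⇒≱ (^-mono-< (ℕ→ℚ-nonNeg n) (ℚₚ.≰⇒> s≰n) (ℚ.denominator-1 t)))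

    -- Rounding supplies a rational p/d above θ, hence above a/b, with n^(p/d) below k + 1; the
    -- comparison is made between d-th powers.
    power-rounding-≥ : ∀ n k a b .{{_ : ℕ.NonZero a}} .{{_ : ℕ.NonZero b}} → Lower θ (+ a ℚ./ b) →
      Rounds k (n ^ʳ θ) → n ℕ.^ a ℕ.≤ suc k ℕ.^ b
    power-rounding-≥ zero    k (suc a) b _ _ = z≤n
    power-rounding-≥ n@(suc _) k a b a/b∈ (_ , q , (t , s , 0<t , t∈ , 0≤s , n^p≤s^d , s<q) , x , y , x<k , y<1 , q<x+y) =
      ^-cancelˡ-≤ d (begin
        (n ℕ.^ a) ℕ.^ d      ≡⟨ ℕₚ.^-*-assoc n a d ⟩
        n ℕ.^ (a ℕ.* d)      ≤⟨ ℕₚ.^-monoʳ-≤ n (ℕₚ.<⇒≤ (cross-< {p = a} {q = p} b d (/-*-cancel a b) (↥↧-cancel 0<t) (lower<upper θ-dedekind a/b∈ t∈))) ⟩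
        n ℕ.^ (p ℕ.* b)      ≡⟨ ℕₚ.^-*-assoc n p b ⟨
        (n ℕ.^ p) ℕ.^ b      ≤⟨ ℕₚ.^-monoˡ-≤ b n^p≤ ⟩
        (suc k ℕ.^ d) ℕ.^ b  ≡⟨ ^-swap (suc k) d b ⟩
        (suc k ℕ.^ b) ℕ.^ d  ∎)
      where
      open ℕₚ.≤-Reasoning
      d p : ℕ
      d = ↧ₙ t
      p = ℤ.∣ ↥ t ∣
      s≤ : s ≤ ℕ→ℚ (suc k)
      s≤ = <⇒≤ (ℚₚ.<-trans s<q (subst (q <_) (ℕ→ℚ-suc k) (ℚₚ.<-trans q<x+y (ℚₚ.+-mono-< x<k y<1))))
      n^p≤ : n ℕ.^ p ℕ.≤ suc k ℕ.^ d
      n^p≤ = ℕ→ℚ-cancel-≤ (subst₂ _≤_ (sym (ℕ→ℚ-^ n p)) (sym (ℕ→ℚ-^ (suc k) d))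
        (≤-trans n^p≤s^d (^-mono-≤ 0≤s s≤ d)))

    -- Locatedness decides only between two distinct rationals. The search therefore tests (i + 1)/N
    -- against (i + 2)/N and encloses θ in an interval of two grid steps.
    bracket : ∀ N .{{_ : ℕ.NonZero N}} → Lower θ 0ℚ → Upper θ 1ℚ →
      ∃[ i ] Lower θ (+ i ℚ./ N) × Upper θ (+ (2 ℕ.+ i) ℚ./ N)
    bracket N 0∈ 1∈ = search N 0 (ℕₚ.+-identityʳ N) (subst (Lower θ) (zero≡ N) 0∈)
      where
      zero≡ : ∀ N .{{_ : ℕ.NonZero N}} → 0ℚ ≡ + 0 ℚ./ N
      zero≡ N = *-cancelʳ-≡-pos (ℕ→ℚ N) (ℕ→ℚ-pos N) (trans (ℚₚ.*-zeroˡ (ℕ→ℚ N)) (sym (/-*-cancel 0 N)))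
      one≡ : ∀ N .{{_ : ℕ.NonZero N}} → + N ℚ./ N ≡ 1ℚ
      one≡ N = *-cancelʳ-≡-pos (ℕ→ℚ N) (ℕ→ℚ-pos N) (trans (/-*-cancel N N) (sym (ℚₚ.*-identityˡ (ℕ→ℚ N))))
      search : ∀ j i → j ℕ.+ i ≡ N → Lower θ (+ i ℚ./ N) → ∃[ i ] Lower θ (+ i ℚ./ N) × Upper θ (+ (2 ℕ.+ i) ℚ./ N)
      search zero    i refl i∈ = contradiction (subst (Lower θ) (one≡ N) i∈ , 1∈) (IsDedekind.disjoint θ-dedekind 1ℚ)
      search (suc j) i eq   i∈ with IsDedekind.located θ-dedekind (+ suc i ℚ./ N) (+ (2 ℕ.+ i) ℚ./ N) (/-mono-< N ℕₚ.≤-refl)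
      ... | inj₁ lower = search j (suc i) (trans (ℕₚ.+-suc j i) eq) lower
      ... | inj₂ upper = i , i∈ , upper

    -- With E the denominator of q one has ε ≥ q ≥ 1/E, and θ ≤ V/N. As (1 - θ)/θ decreases in θ,
    -- this gives m ≥ 2 (1 + 1/E) ((N - V)/V) k, here with denominators cleared.
    m-para-bound : ∀ {ε q} N V k m .{{_ : ℕ.NonZero N}} .{{_ : ℕ.NonZero V}} → IsDedekind ε → 0ℚ < q → Lower ε q →
      Upper θ (+ V ℚ./ N) → V ℕ.≤ N → (fromℕ 1 +ʳ ε) *ʳ m-para θ k <ʳ fromℕ m →
      2 ℕ.* (↧ₙ q ℕ.+ 1) ℕ.* (N ℕ.∸ V) ℕ.* k ℕ.≤ ↧ₙ q ℕ.* V ℕ.* m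
    m-para-bound {ε} {q} N V k m ε-dedekind 0<q q∈ v∈ V≤N mpara<m = begin
      2 ℕ.* (E ℕ.+ 1) ℕ.* (N ℕ.∸ V) ℕ.* k
        ≤⟨ ℕₚ.*-monoˡ-≤ k (ℕₚ.*-monoˡ-≤ (N ℕ.∸ V) (ℕₚ.*-monoʳ-≤ 2 (ℕₚ.+-monoʳ-≤ E 1≤p))) ⟩
      2 ℕ.* (E ℕ.+ p) ℕ.* (N ℕ.∸ V) ℕ.* k
        ≡⟨ ringˡ (E ℕ.+ p) (N ℕ.∸ V) k ⟩
      (E ℕ.+ p) ℕ.* (2 ℕ.* (N ℕ.∸ V) ℕ.* k)
        ≤⟨ ℕ→ℚ-cancel-≤ (subst₂ _≤_ left right (ℚₚ.*-monoʳ-≤-nonNeg (ℕ→ℚ E * ℕ→ℚ V)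
             {{ℚ.nonNegative (*-nonNeg (ℕ→ℚ-nonNeg E) (ℕ→ℚ-nonNeg V))}} bound)) ⟩
      m ℕ.* (E ℕ.* V)
        ≡⟨ ℕₚ.*-comm m (E ℕ.* V) ⟩
      E ℕ.* V ℕ.* m ∎
      where
      open ℕₚ.≤-Reasoning

      E p : ℕ
      E = ↧ₙ q
      p = ℤ.∣ ↥ q ∣
      v g δ : ℚ
      v = + V ℚ./ N
      g = + N ℚ./ V
      δ = 1ℚ + - v
      1≤p : 1 ℕ.≤ p
      1≤p = ℕ→ℚ-cancel-< {0} {p} (subst₂ _<_ (ℚₚ.*-zeroˡ (ℕ→ℚ E)) (↥↧-cancel 0<q)
        (ℚₚ.*-monoˡ-<-pos (ℕ→ℚ E) {{ℚ.positive (ℕ→ℚ-pos E)}} 0<q))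
      gv≡1 : g * v ≡ 1ℚ
      gv≡1 = *-cancelʳ-≡-pos (ℕ→ℚ N) (ℕ→ℚ-pos N) (trans (ℚₚ.*-assoc g v (ℕ→ℚ N))
        (trans (cong (g *_) (/-*-cancel V N)) (trans (/-*-cancel N V) (sym (ℚₚ.*-identityˡ (ℕ→ℚ N))))))
      0<v : 0ℚ < v
      0<v = ℚₚ.*-cancelʳ-<-nonNeg (ℕ→ℚ N) {{ℚ.nonNegative (ℕ→ℚ-nonNeg N)}}
        (subst₂ _<_ (sym (ℚₚ.*-zeroˡ (ℕ→ℚ N))) (sym (/-*-cancel V N)) (ℕ→ℚ-pos V))
      0≤g : 0ℚ ≤ g
      0≤g = ℚₚ.*-cancelʳ-≤-pos (ℕ→ℚ V) {{ℚ.positive (ℕ→ℚ-pos V)}}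
        (subst₂ _≤_ (sym (ℚₚ.*-zeroˡ (ℕ→ℚ V))) (sym (/-*-cancel N V)) (ℕ→ℚ-nonNeg N))
      δN : δ * ℕ→ℚ N ≡ ℕ→ℚ (N ℕ.∸ V)
      δN = trans (solve 2 (λ v n → (con 1ℚ :+ (:- v)) :* n := n :+ (:- (v :* n))) refl v (ℕ→ℚ N))
        (trans (cong₂ (λ x y → x + - y) (trans (cong ℕ→ℚ (sym (ℕₚ.m∸n+n≡m V≤N))) (ℕ→ℚ-+ (N ℕ.∸ V) V)) (/-*-cancel V N))
          (solve 2 (λ x y → (x :+ y) :+ (:- y) := x) refl (ℕ→ℚ (N ℕ.∸ V)) (ℕ→ℚ V)))
      0≤δ : 0ℚ ≤ δ
      0≤δ = ℚₚ.*-cancelʳ-≤-pos (ℕ→ℚ N) {{ℚ.positive (ℕ→ℚ-pos N)}}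
        (subst₂ _≤_ (sym (ℚₚ.*-zeroˡ (ℕ→ℚ N))) (sym δN) (ℕ→ℚ-nonNeg (N ℕ.∸ V)))
      0≤δg : 0ℚ ≤ δ * g
      0≤δg = *-nonNeg 0≤δ 0≤g
      0≤2δg : 0ℚ ≤ ℕ→ℚ 2 * (δ * g)
      0≤2δg = *-nonNeg (ℕ→ℚ-nonNeg 2) 0≤δg
      bound : (ℕ→ℚ 1 + q) * (ℕ→ℚ 2 * (δ * g) * ℕ→ℚ k) ≤ ℕ→ℚ m
      bound = ≲-<ʳ {(ℕ→ℚ 1 + q) * (ℕ→ℚ 2 * (δ * g) * ℕ→ℚ k)} {(fromℕ 1 +ʳ ε) *ʳ m-para θ k} m
        (≲-* {ℕ→ℚ 1 + q} {ℕ→ℚ 2 * (δ * g) * ℕ→ℚ k} {fromℕ 1 +ʳ ε} {m-para θ k}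
          (≤-trans (ℕ→ℚ-nonNeg 1) (subst (_≤ ℕ→ℚ 1 + q) (ℚₚ.+-identityʳ (ℕ→ℚ 1)) (ℚₚ.+-monoʳ-≤ (ℕ→ℚ 1) (<⇒≤ 0<q))))
          (*-nonNeg 0≤2δg (ℕ→ℚ-nonNeg k))
          (≲-+ {ℕ→ℚ 1} {q} {fromℕ 1} {ε} (≲-fromℚ (ℕ→ℚ 1)) (≲-lower ε-dedekind q∈))
          (≲-* {ℕ→ℚ 2 * (δ * g)} {ℕ→ℚ k} {fromℕ 2 *ʳ ((fromℕ 1 -ʳ θ) *ʳ θ ⁻¹ʳ)} {fromℕ k} 0≤2δg (ℕ→ℚ-nonNeg k)
            (≲-* {ℕ→ℚ 2} {δ * g} {fromℕ 2} {(fromℕ 1 -ʳ θ) *ʳ θ ⁻¹ʳ} (ℕ→ℚ-nonNeg 2) 0≤δg (≲-fromℚ (ℕ→ℚ 2))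
              (≲-* {δ} {g} {fromℕ 1 -ʳ θ} {θ ⁻¹ʳ} 0≤δ 0≤g
                (≲-+ {ℕ→ℚ 1} { - v} {fromℕ 1} { -ʳ θ} (≲-fromℚ (ℕ→ℚ 1)) (≲-neg θ-dedekind v∈))
                (≲-⁻¹ {θ} {v} {g} θ-dedekind v∈ 0<v gv≡1)))
            (≲-fromℚ (ℕ→ℚ k))))
        mpara<m
      left : (ℕ→ℚ 1 + q) * (ℕ→ℚ 2 * (δ * g) * ℕ→ℚ k) * (ℕ→ℚ E * ℕ→ℚ V) ≡ ℕ→ℚ ((E ℕ.+ p) ℕ.* (2 ℕ.* (N ℕ.∸ V) ℕ.* k))
      left = trans
        (solve 7 (λ q t d g k e v → (con 1ℚ :+ q) :* (t :* (d :* g) :* k) :* (e :* v) := (e :+ q :* e) :* (t :* (d :* (g :* v)) :* k))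
          refl q (ℕ→ℚ 2) δ g (ℕ→ℚ k) (ℕ→ℚ E) (ℕ→ℚ V))
        (trans (cong₂ (λ x y → (ℕ→ℚ E + x) * (ℕ→ℚ 2 * y * ℕ→ℚ k)) (↥↧-cancel 0<q)
                 (trans (cong (δ *_) (/-*-cancel N V)) δN))
          (trans (cong₂ (λ x y → x * (y * ℕ→ℚ k)) (sym (ℕ→ℚ-+ E p)) (sym (ℕ→ℚ-* 2 (N ℕ.∸ V))))
            (trans (cong (ℕ→ℚ (E ℕ.+ p) *_) (sym (ℕ→ℚ-* (2 ℕ.* (N ℕ.∸ V)) k))) (sym (ℕ→ℚ-* (E ℕ.+ p) (2 ℕ.* (N ℕ.∸ V) ℕ.* k))))))
      right : ℕ→ℚ m * (ℕ→ℚ E * ℕ→ℚ V) ≡ ℕ→ℚ (m ℕ.* (E ℕ.* V))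
      right = trans (cong (ℕ→ℚ m *_) (sym (ℕ→ℚ-* E V))) (sym (ℕ→ℚ-* m (E ℕ.* V)))
      ringˡ : ∀ x y z → 2 ℕ.* x ℕ.* y ℕ.* z ≡ x ℕ.* (2 ℕ.* y ℕ.* z)
      ringˡ = solve-∀

  -- The whole interface between the real parameters and the estimates in natural numbers. The ratio
  -- c/a equals (1 - a/b)/(a/b), so `gap` says that P/Q exceeds `m-para` per one, taken at a/b in
  -- place of θ.
  record Exponents (θ ε : Cut) : Set where
    field
      a b c P Q : ℕ
      a≢0       : ℕ.NonZero a
      Q≢0       : ℕ.NonZero Q
      b≡a+c     : b ≡ a ℕ.+ c
      gap       : 2 ℕ.* Q ℕ.* c ℕ.< P ℕ.* a
      n-bound   : ∀ n k → Rounds k (n ^ʳ θ) → n ℕ.^ a ℕ.≤ suc k ℕ.^ b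
      m-bound   : ∀ k m → (fromℕ 1 +ʳ ε) *ʳ m-para θ k <ʳ fromℕ m → P ℕ.* k ℕ.≤ Q ℕ.* m

  -- Divided by 2 E i x this is (1 + 2/i) (1 + 2/x) < 1 + 1/E: the width of the bracket must cost
  -- less than ε gives. At i, x ≥ 2 (2 E + 1) each factor is at most 1 + 1/(2 E + 1), whose square
  -- is below 1 + 1/E.
  gap-bound : ∀ E i x → 2 ℕ.+ 4 ℕ.* E ℕ.≤ i → 2 ℕ.+ 4 ℕ.* E ℕ.≤ x →
    2 ℕ.* (E ℕ.* (2 ℕ.+ i)) ℕ.* (x ℕ.+ 2) ℕ.< 2 ℕ.* (E ℕ.+ 1) ℕ.* x ℕ.* i
  gap-bound E i x i≥ x≥ with ℕₚ.m≤n⇒∃[o]m+o≡n i≥ | ℕₚ.m≤n⇒∃[o]m+o≡n x≥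
  ... | j , refl | l , refl = subst (2 ℕ.* (E ℕ.* (2 ℕ.+ i)) ℕ.* (x ℕ.+ 2) ℕ.<_) (ring E j l) (ℕₚ.m<m+n _ (s≤s z≤n))
    where
    ring : ∀ E j l → 2 ℕ.* (E ℕ.* (2 ℕ.+ (2 ℕ.+ 4 ℕ.* E ℕ.+ j))) ℕ.* ((2 ℕ.+ 4 ℕ.* E ℕ.+ l) ℕ.+ 2)
        ℕ.+ suc (7 ℕ.+ 8 ℕ.* E ℕ.+ 2 ℕ.* (2 ℕ.+ 2 ℕ.* E) ℕ.* (j ℕ.+ l) ℕ.+ 2 ℕ.* j ℕ.* l)
      ≡ 2 ℕ.* (E ℕ.+ 1) ℕ.* (2 ℕ.+ 4 ℕ.* E ℕ.+ l) ℕ.* (2 ℕ.+ 4 ℕ.* E ℕ.+ j)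
    ring = solve-∀

  -- With N = d₀ d₁ M, the fraction V/N exceeds p₀/d₀ ≥ 1/d₀, so V > N/d₀ ≥ M.
  grid-≥ : ∀ d₀ d₁ M {p₀ V} .{{_ : ℕ.NonZero d₀}} .{{_ : ℕ.NonZero d₁}} → 1 ℕ.≤ p₀ →
    p₀ ℕ.* (d₀ ℕ.* (d₁ ℕ.* M)) ℕ.< V ℕ.* d₀ → M ℕ.< V
  grid-≥ d₀ d₁ M {p₀} {V} 1≤p₀ p₀N<Vd₀ = ℕₚ.*-cancelˡ-< d₀ M V (begin-strict
    d₀ ℕ.* M                          ≤⟨ ℕₚ.*-monoʳ-≤ d₀ (ℕₚ.m≤n*m M d₁) ⟩
    d₀ ℕ.* (d₁ ℕ.* M)                 ≤⟨ ℕₚ.m≤n*m _ p₀ {{ℕ.>-nonZero 1≤p₀}} ⟩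
    p₀ ℕ.* (d₀ ℕ.* (d₁ ℕ.* M))        <⟨ p₀N<Vd₀ ⟩
    V ℕ.* d₀                          ≡⟨ ℕₚ.*-comm V d₀ ⟩
    d₀ ℕ.* V                          ∎)
    where open ℕₚ.≤-Reasoning

  -- The mirror image at 1: i/N < p₁/d₁ ≤ 1 - 1/d₁, and N/d₁ ≥ M.
  grid-≤ : ∀ d₀ d₁ M {p₁ i} .{{_ : ℕ.NonZero d₀}} .{{_ : ℕ.NonZero d₁}} → p₁ ℕ.< d₁ →
    i ℕ.* d₁ ℕ.< p₁ ℕ.* (d₀ ℕ.* (d₁ ℕ.* M)) → i ℕ.+ M ℕ.< d₀ ℕ.* (d₁ ℕ.* M)
  grid-≤ d₀ d₁ M {p₁} {i} p₁<d₁ id₁<p₁N = begin-strict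
    i ℕ.+ M                           <⟨ ℕₚ.+-mono-<-≤ i<p₁d₀M (ℕₚ.m≤n*m M d₀) ⟩
    p₁ ℕ.* (d₀ ℕ.* M) ℕ.+ d₀ ℕ.* M    ≡⟨ ℕₚ.+-comm (p₁ ℕ.* (d₀ ℕ.* M)) (d₀ ℕ.* M) ⟩
    suc p₁ ℕ.* (d₀ ℕ.* M)             ≤⟨ ℕₚ.*-monoˡ-≤ (d₀ ℕ.* M) p₁<d₁ ⟩
    d₁ ℕ.* (d₀ ℕ.* M)                 ≡⟨ ring₁ d₁ d₀ M ⟩
    d₀ ℕ.* (d₁ ℕ.* M)                 ∎
    where
    open ℕₚ.≤-Reasoning
    ring₁ : ∀ x y m → x ℕ.* (y ℕ.* m) ≡ y ℕ.* (x ℕ.* m)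
    ring₁ = solve-∀
    ring₂ : ∀ p x y m → p ℕ.* (x ℕ.* (y ℕ.* m)) ≡ p ℕ.* (x ℕ.* m) ℕ.* y
    ring₂ = solve-∀
    i<p₁d₀M : i ℕ.< p₁ ℕ.* (d₀ ℕ.* M)
    i<p₁d₀M = ℕₚ.*-cancelʳ-< d₁ i (p₁ ℕ.* (d₀ ℕ.* M)) (ℕₚ.<-≤-trans id₁<p₁N (ℕₚ.≤-reflexive (ring₂ p₁ d₀ d₁ M)))

  -- For a grid point i/N just below θ and V/N just above it, V = i + 2, the
  -- ratio P/Q of the exponents is 2 (1 + 1/E) (1 - V/N) / (V/N).
  module _ {θ ε : Cut} (θ-dedekind : IsDedekind θ) (ε-dedekind : IsDedekind ε) where

    exponents-at : ∀ {q E} i N .{{_ : ℕ.NonZero N}} → ↧ₙ q ≡ E → 0ℚ < q → Lower ε q →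
      Lower θ (+ i ℚ./ N) → Upper θ (+ (2 ℕ.+ i) ℚ./ N) →
      2 ℕ.+ 4 ℕ.* E ℕ.≤ i → i ℕ.+ (3 ℕ.+ 4 ℕ.* E) ℕ.< N → Exponents θ ε
    exponents-at {q} i N refl 0<q q∈ i∈ V∈ i≥ i+M<N = record
      { a = i ; b = N ; c = N ℕ.∸ i
      ; P = 2 ℕ.* (E ℕ.+ 1) ℕ.* (N ℕ.∸ V) ; Q = E ℕ.* V
      ; a≢0 = a≢0
      ; Q≢0 = ℕₚ.m*n≢0 E V
      ; b≡a+c = sym (ℕₚ.m+[n∸m]≡n (ℕₚ.≤-trans (ℕₚ.m≤n+m i 2) V≤N))
      ; gap = subst (λ y → 2 ℕ.* (E ℕ.* V) ℕ.* y ℕ.< 2 ℕ.* (E ℕ.+ 1) ℕ.* (N ℕ.∸ V) ℕ.* i) x+2≡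
                (gap-bound E i (N ℕ.∸ V) i≥ x≥)
      ; n-bound = λ n k → power-rounding-≥ θ-dedekind n k i N {{a≢0}} i∈
      ; m-bound = λ k m → m-para-bound θ-dedekind N V k m ε-dedekind 0<q q∈ V∈ V≤N
      }
      where
      E V : ℕ
      E = ↧ₙ q
      V = 2 ℕ.+ i
      a≢0 : ℕ.NonZero i
      a≢0 = ℕ.>-nonZero (ℕₚ.≤-trans (s≤s z≤n) i≥)
      V+x≤N : V ℕ.+ (2 ℕ.+ 4 ℕ.* E) ℕ.≤ N
      V+x≤N = subst (ℕ._≤ N) (ring i (4 ℕ.* E)) i+M<N
        where
        ring : ∀ i e → 1 ℕ.+ (i ℕ.+ (3 ℕ.+ e)) ≡ (2 ℕ.+ i) ℕ.+ (2 ℕ.+ e)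
        ring = solve-∀
      V≤N : V ℕ.≤ N
      V≤N = ℕₚ.m+n≤o⇒m≤o V V+x≤N
      x≥ : 2 ℕ.+ 4 ℕ.* E ℕ.≤ N ℕ.∸ V
      x≥ = subst (ℕ._≤ N ℕ.∸ V) (ℕₚ.m+n∸m≡n V (2 ℕ.+ 4 ℕ.* E)) (ℕₚ.∸-monoˡ-≤ V V+x≤N)
      x+2≡ : N ℕ.∸ V ℕ.+ 2 ≡ N ℕ.∸ i
      x+2≡ = trans (sym (ℕₚ.m+n∸n≡m (N ℕ.∸ V ℕ.+ 2) i)) (cong (ℕ._∸ i)
        (trans (ℕₚ.+-assoc (N ℕ.∸ V) 2 i) (ℕₚ.m∸n+n≡m V≤N)))

    exponents : fromℕ 0 <ʳ θ → θ <ʳ fromℕ 1 → fromℕ 0 <ʳ ε → Exponents θ ε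
    exponents (q₀ , 0<q₀ , q₀∈) (q₁ , q₁∈ , q₁<1) (q , 0<q , q∈) = construct (d₀ ℕ.* (d₁ ℕ.* M)) refl
      where
      M d₀ d₁ p₀ p₁ : ℕ
      -- Just enough grid points on both sides of θ: V > M means i ≥ 2 + 4 E, and i + M < N means N
      -- - V ≥ 2 + 4 E, where E is the denominator of q. These are the hypotheses of `gap-bound`.
      M  = 3 ℕ.+ 4 ℕ.* ↧ₙ q
      d₀ = ↧ₙ q₀
      d₁ = ↧ₙ q₁
      p₀ = ℤ.∣ ↥ q₀ ∣
      p₁ = ℤ.∣ ↥ q₁ ∣
      0<q₁ : 0ℚ < q₁
      0<q₁ = ℚₚ.<-trans 0<q₀ (lower<upper θ-dedekind q₀∈ q₁∈)
      1≤p₀ : 1 ℕ.≤ p₀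
      1≤p₀ = subst (1 ℕ.≤_) (ℕₚ.*-identityʳ p₀) (cross-< {p = 0} {q = p₀} 1 d₀ refl (↥↧-cancel 0<q₀) 0<q₀)
      p₁<d₁ : p₁ ℕ.< d₁
      p₁<d₁ = subst₂ ℕ._<_ (ℕₚ.*-identityʳ p₁) (ℕₚ.*-identityˡ d₁) (cross-< {p = p₁} {q = 1} d₁ 1 (↥↧-cancel 0<q₁) refl q₁<1)
      construct : ∀ N .{{_ : ℕ.NonZero N}} → N ≡ d₀ ℕ.* (d₁ ℕ.* M) → Exponents θ ε
      construct N N≡ with bracket θ-dedekind N
          (Equivalence.from (IsDedekind.lower-rounded θ-dedekind 0ℚ) (q₀ , 0<q₀ , q₀∈))
          (Equivalence.from (IsDedekind.upper-rounded θ-dedekind 1ℚ) (q₁ , q₁<1 , q₁∈))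
      ... | i , i∈ , V∈ = exponents-at i N refl 0<q q∈ i∈ V∈
        (ℕₚ.≤-pred (ℕₚ.≤-pred (grid-≥ d₀ d₁ M 1≤p₀ (subst (λ N → p₀ ℕ.* N ℕ.< (2 ℕ.+ i) ℕ.* d₀) N≡
          (cross-< {p = p₀} {q = 2 ℕ.+ i} d₀ N (↥↧-cancel 0<q₀) (/-*-cancel (2 ℕ.+ i) N) (lower<upper θ-dedekind q₀∈ V∈))))))
        (subst (i ℕ.+ M ℕ.<_) (sym N≡) (grid-≤ d₀ d₁ M p₁<d₁ (subst (λ N → i ℕ.* d₁ ℕ.< p₁ ℕ.* N) N≡
          (cross-< {p = i} {q = p₁} N d₁ (/-*-cancel i N) (↥↧-cancel 0<q₁) (lower<upper θ-dedekind i∈ q₁∈)))))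

-- Success probability tending to one.

module Convergence where
  open import Data.Rational using (_*_; _<_)
  open +-*-Solver using (solve; _:+_; _:*_; :-_; con; _:=_)
  open Counting
  open Decoding
  open Asymptotics
  open Cuts using (Exponents; ℕ→ℚ-+; ℕ→ℚ-pos; ℕ→ℚ-nonNeg; /-*-cancel; ↥↧-cancel; cross-<; uncross-<; half-rounding; power-rounding-≤)

  count-complement : ∀ {A : Set} {P : Pred A 0ℓ} (P? : Decidable P) → ∀ xs →
    count P? xs ℕ.+ count (¬? ∘ P?) xs ≡ length xs
  count-complement P? []       = refl
  count-complement P? (x ∷ xs) with P? x
  ... | yes _ = cong suc (count-complement P? xs)
  ... | no  _ = trans (ℕₚ.+-suc _ _) (cong suc (count-complement P? xs))

  -- A failure proportion of at most 1/(D + 1), with D the denominator of η, is strictly below 1/D ≤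
  -- η. Hence the later choice of H as D + 1.
  Pr-near-1 : ∀ {Ω : Set} {P : Pred Ω 0ℓ} (P? : Decidable P) ωs .{{_ : ℕ.NonZero (length ωs)}} {η} → 0ℚ < η →
    suc (↧ₙ η) ℕ.* count (¬? ∘ P?) ωs ℕ.≤ length ωs → ℚ.∣ Pr ωs P? ℚ.- 1ℚ ∣ < η
  Pr-near-1 P? ωs@(_ ∷ ωs′) {η} 0<η few = subst (_< η) (sym ∣p-1∣≡)
    (uncross-< {p = f} {q = ℤ.∣ ↥ η ∣} L (↧ₙ η) 1-p≡ (↥↧-cancel 0<η) (begin-strict
      f ℕ.* ↧ₙ η               <⟨ f*d<L few ⟩
      L                        ≤⟨ ℕₚ.m≤n*m L ℤ.∣ ↥ η ∣ {{ℕ.>-nonZero num>0}} ⟩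
      ℤ.∣ ↥ η ∣ ℕ.* L          ∎))
    where
    open ℕₚ.≤-Reasoning
    L s f : ℕ
    L = suc (length ωs′)
    s = count P? ωs
    f = count (¬? ∘ P?) ωs
    p : ℚ
    p = Pr ωs P?
    num>0 : 0 ℕ.< ℤ.∣ ↥ η ∣
    num>0 = subst₂ ℕ._<_ refl (ℕₚ.*-identityʳ _) (cross-< {p = 0} {q = ℤ.∣ ↥ η ∣} 1 (↧ₙ η) refl (↥↧-cancel 0<η) 0<η)
    f*d<L : suc (↧ₙ η) ℕ.* f ℕ.≤ L → f ℕ.* ↧ₙ η ℕ.< L
    f*d<L few with f
    ... | zero   = s≤s z≤n
    ... | suc f′ = ℕₚ.<-≤-trans (subst (ℕ._< suc f′ ℕ.+ ↧ₙ η ℕ.* suc f′) (ℕₚ.*-comm (↧ₙ η) (suc f′))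
                     (ℕₚ.m<n+m (↧ₙ η ℕ.* suc f′) (s≤s z≤n))) few
    1-p≡ : (1ℚ ℚ.- p) * ℕ→ℚ L ≡ ℕ→ℚ f
    1-p≡ = trans (solve 2 (λ p l → (con 1ℚ :+ (:- p)) :* l := l :+ (:- (p :* l))) refl p (ℕ→ℚ L))
      (trans (cong₂ (λ x y → x ℚ.+ ℚ.- y) (trans (cong ℕ→ℚ (sym (count-complement P? ωs))) (ℕ→ℚ-+ s f)) (/-*-cancel s L))
        (solve 2 (λ s f → (s :+ f) :+ (:- s) := f) refl (ℕ→ℚ s) (ℕ→ℚ f)))
    0≤1-p : 0ℚ ℚ.≤ 1ℚ ℚ.- p
    0≤1-p = ℚₚ.*-cancelʳ-≤-pos (ℕ→ℚ L) {{ℚ.positive (ℕ→ℚ-pos L)}}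
      (subst₂ ℚ._≤_ (sym (ℚₚ.*-zeroˡ (ℕ→ℚ L))) (sym 1-p≡) (ℕ→ℚ-nonNeg f))
    ∣p-1∣≡ : ℚ.∣ p ℚ.- 1ℚ ∣ ≡ 1ℚ ℚ.- p
    ∣p-1∣≡ = trans (cong ℚ.∣_∣ (solve 1 (λ p → p :+ (:- con 1ℚ) := :- (con 1ℚ :+ (:- p))) refl p))
      (trans (ℚₚ.∣-p∣≡∣p∣ (1ℚ ℚ.- p)) (ℚₚ.0≤p⇒∣p∣≡p 0≤1-p))

  ∃-weight : ∀ n k → k ℕ.≤ n → ∃[ σ ] weight {n} σ ≡ k
  ∃-weight zero    zero    z≤n       = [] , refl
  ∃-weight (suc n) zero    z≤n       with ∃-weight n 0 z≤n
  ... | σ , eq = zero ∷ σ , eq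
  ∃-weight (suc n) (suc k) (s≤s k≤n) with ∃-weight n k k≤n
  ... | σ , eq = suc zero ∷ σ , cong suc eq

  outcomes-nonempty : ∀ n k m Γ .{{_ : ℕ.NonZero n}} → k ℕ.≤ n →
    ℕ.NonZero (length (cartesianProduct (signals n k) (draws n m Γ)))
  outcomes-nonempty n k m Γ k≤n with ∃-weight n k k≤n
  ... | σ , eq = subst ℕ.NonZero (sym (length-cartesianProductWith _,_ (signals n k) (draws n m Γ)))
    (ℕₚ.m*n≢0 (length (signals n k)) (length (draws n m Γ))
      {{nonempty (∈-filter⁺ (λ σ → weight σ ℕ.≟ k) (∈-vectors ∈-allFin σ) eq)}}
      {{subst ℕ.NonZero (sym (length-draws n m Γ)) (ℕₚ.m^n≢0 (n ℕ.^ Γ) m {{ℕₚ.m^n≢0 n Γ}})}})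

  decoder-succeeds : ∀ {θ ε} → IsDedekind θ → θ <ʳ fromℕ 1 → Exponents θ ε → (k Γ m : ℕ → ℕ) →
    (∀ n → Rounds (k n) (n ^ʳ θ)) →
    (∀ n → Rounds (Γ n) (fromℕ n *ʳ fromℚ ½)) →
    (∀ n → (fromℕ 1 +ʳ ε) *ʳ m-para θ (k n) <ʳ fromℕ (m n)) →
    TendsToOne (λ n → Pr-success n (k n) (m n) (Γ n) (decoder n (k n) (m n)))
  decoder-succeeds θ-dedekind θ<1 exps k Γ m k≈ Γ≈ m> η 0<η
    with asymptotics a b c P Q (suc (↧ₙ η)) {{a≢0}} {{Q≢0}} b≡a+c gap
    where open Exponents exps
  -- The 5 provides the n ≥ 5 under which the constant 3/4 holds.
  ... | N , eventually = 5 ℕ.+ N , success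
    where
    open Exponents exps
    success : ∀ n → 5 ℕ.+ N ℕ.≤ n →
      ℚ.∣ Pr-success n (k n) (m n) (Γ n) (decoder n (k n) (m n)) ℚ.- 1ℚ ∣ < η
    success n N≤n = conclude
      (eventually n (k n) (m n) (ℕₚ.≤-trans (ℕₚ.m≤n+m N 5) N≤n) (n-bound n (k n) (k≈ n)) (m-bound (k n) (m n) (m> n)))
      where
      n≥5 : 5 ℕ.≤ n
      n≥5 = ℕₚ.m+n≤o⇒m≤o 5 N≤n
      instance
        n≢0 : ℕ.NonZero n
        n≢0 = ℕ.>-nonZero (ℕₚ.≤-trans (s≤s z≤n) n≥5)
      conclude : _ → ℚ.∣ Pr-success n (k n) (m n) (Γ n) (decoder n (k n) (m n)) ℚ.- 1ℚ ∣ < η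
      conclude (d₀ , near , far) = Pr-near-1
        (λ (σ , ω) → Vecₚ.≡-dec Fin._≟_ (decoder n (k n) (m n) (multigraph ω) (results (multigraph ω) σ)) σ)
        (cartesianProduct (signals n (k n)) (draws n (m n) (Γ n)))
        {{outcomes-nonempty n (k n) (m n) (Γ n) (power-rounding-≤ θ-dedekind n (k n) θ<1 (k≈ n))}} 0<η
        (failures {n} {k n} {m n} {Γ n} {suc (↧ₙ η)} {d₀} n≥5 (half-rounding n (Γ n) (Γ≈ n)) near
          (far (length (signals n (k n))) (length-signals n (k n))))

theorem2 : (θ ε : Cut) → IsDedekind θ → IsDedekind ε →
    fromℕ 0 <ʳ θ → θ <ʳ fromℕ 1 → fromℕ 0 <ʳ ε →
    (k Γ m : ℕ → ℕ) →
    (∀ n → Rounds (k n) (n ^ʳ θ)) →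
    (∀ n → Rounds (Γ n) (fromℕ n *ʳ fromℚ ½)) →
    (∀ n → (fromℕ 1 +ʳ ε) *ʳ m-para θ (k n) <ʳ fromℕ (m n)) →
    ∃ λ (decode : ∀ n → Decoder n (m n)) →
    TendsToOne (λ n → Pr-success n (k n) (m n) (Γ n) (decode n))
theorem2 θ ε θ-dedekind ε-dedekind 0<θ θ<1 0<ε k Γ m k≈ Γ≈ m> =
  (λ n → Decoding.decoder n (k n) (m n)) ,
  Convergence.decoder-succeeds θ-dedekind θ<1 (Cuts.exponents θ-dedekind ε-dedekind 0<θ θ<1 0<ε) k Γ m k≈ Γ≈ m>
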